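{- Let $A$ be an integer weighing matrix with $$A\sim_H A_1^{\oplus r_1}\oplus A_2^{\oplus r_2}\oplus\cdots\oplus A_s^{\oplus r_s},$$ where the $A_i$ are primitive integer weighing matrices and $A_i$, $A_j$ are not H-equivalent for $i\neq j$. Then $$\mathrm{Aut}(A)\cong\prod_{t=1}^s \mathrm{Aut}(A_t)\wr S_{r_t}.$$ In particular $|\mathrm{Aut}(A)|=\prod_{t=1}^s|\mathrm{Aut}(A_t)|^{r_t}\,r_t!$.
   Context: An integer weighing matrix is a square integer matrix $A$ with $AA^\top=kI$ for some integer $k$. $\mathrm{Mon}(n)$ is the set of $n\times n$ monomial matrices with entries in $\{0,\pm1\}$. $A\sim_H B$ means $B=LAR^\top$ with $L,R$ monomial. $\mathrm{Aut}(A)=\{(L,R)\in\mathrm{Mon}(n)^2: LAR^\top=A\}$, a group under componentwise multiplication. $X^{\oplus r}$ is the block diagonal sum of $r$ copies of $X$. A primitive integer weighing matrix is one not H-equivalent to a block diagonal sum of two or more smaller square blocks. For a group $H$, $H\wr S_r$ is the semidirect product $H^r\rtimes S_r$ with $S_r$ permuting the coordinates.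
   Formalization: The weight k of A is assumed positive and every block A_i is assumed of order at least 1; without this the claim fails, e.g. for the 2×2 zero matrix [0]⊕[0], where |Aut(A)|=64 but the formula gives 32. -}

module Defs where

open import Data.Nat using (ℕ; zero; suc; _+_; _*_; _^_; _≤_)

open import Data.Integer using (ℤ; +_; -_; 0ℤ; 1ℤ; -1ℤ) renaming (_+_ to _+ℤ_; _*_ to _*ℤ_)
open import Data.Fin using (Fin; zero; suc; splitAt)
open import Data.Fin.Permutation using (Permutation′; _⟨$⟩ʳ_; _⟨$⟩ˡ_)
open import Data.Product using (Σ; ∃; _×_; _,_; proj₁; proj₂)
open import Data.Sum using (_⊎_; inj₁; inj₂)
open import Relation.Binary.PropositionalEquality using (_≡_; _≢_; subst)
open import Relation.Nullary using (¬_)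

Mat : ℕ → ℕ → Set
Mat m n = Fin m → Fin n → ℤ

SqMat : ℕ → Set
SqMat n = Mat n n

∑ : (n : ℕ) → (Fin n → ℤ) → ℤ
∑ zero    f = 0ℤ
∑ (suc n) f = f zero +ℤ ∑ n (λ i → f (suc i))

_·_ : {m n p : ℕ} → Mat m n → Mat n p → Mat m p
_·_ {n = n} X Y i k = ∑ n (λ j → X i j *ℤ Y j k)

infixl 7 _·_

_ᵀ : {m n : ℕ} → Mat m n → Mat n m
(X ᵀ) i j = X j i

_≈M_ : {m n : ℕ} → Mat m n → Mat m n → Set
X ≈M Y = ∀ i j → X i j ≡ Y i j

infix 4 _≈M_

scalarI : (n : ℕ) → ℤ → SqMat n
scalarI n k i j with i Data.Fin.≟ j
... | Relation.Nullary.yes _ = k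
... | Relation.Nullary.no  _ = 0ℤ
  where import Data.Fin

IsWeighingOfWeight : {n : ℕ} → ℤ → SqMat n → Set
IsWeighingOfWeight {n} k A = A · (A ᵀ) ≈M scalarI n k

IsIntWeighing : {n : ℕ} → SqMat n → Set
IsIntWeighing A = Σ ℤ λ k → IsWeighingOfWeight k A

IsMonomial : {n : ℕ} → SqMat n → Set
IsMonomial {n} L =
    (∀ i j → (L i j ≡ 0ℤ) ⊎ (L i j ≡ 1ℤ) ⊎ (L i j ≡ -1ℤ))
  × (∀ i → Σ (Fin n) λ j → (L i j ≢ 0ℤ) × (∀ j′ → L i j′ ≢ 0ℤ → j′ ≡ j))
  × (∀ j → Σ (Fin n) λ i → (L i j ≢ 0ℤ) × (∀ i′ → L i′ j ≢ 0ℤ → i′ ≡ i))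

_∼H_ : {n : ℕ} → SqMat n → SqMat n → Set
_∼H_ {n} A B = Σ (SqMat n) λ L → Σ (SqMat n) λ R →
  IsMonomial L × IsMonomial R × (L · A · (R ᵀ) ≈M B)

infix 4 _∼H_

_⊕_ : {m n : ℕ} → SqMat m → SqMat n → SqMat (m + n)
_⊕_ {m} X Y i j with splitAt m i | splitAt m j
... | inj₁ a | inj₁ b = X a b
... | inj₂ a | inj₂ b = Y a b
... | inj₁ _ | inj₂ _ = 0ℤ
... | inj₂ _ | inj₁ _ = 0ℤ

emptyMat : SqMat 0
emptyMat ()

_^⊕_ : {m : ℕ} → SqMat m → (r : ℕ) → SqMat (r * m)
X ^⊕ zero  = emptyMat
X ^⊕ suc r = X ⊕ (X ^⊕ r)

blockDim : (s : ℕ) → (n r : Fin s → ℕ) → ℕ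
blockDim zero    n r = 0
blockDim (suc s) n r = r zero * n zero + blockDim s (λ t → n (suc t)) (λ t → r (suc t))

blockSum : (s : ℕ) → (n r : Fin s → ℕ) → (A : (t : Fin s) → SqMat (n t)) →
           SqMat (blockDim s n r)
blockSum zero    n r A = emptyMat
blockSum (suc s) n r A =
  (A zero ^⊕ r zero) ⊕ blockSum s (λ t → n (suc t)) (λ t → r (suc t)) (λ t → A (suc t))

-- Primitive: not H-equivalent to a block diagonal sum of two or more
-- smaller square blocks (equivalently, to B ⊕ C with B, C of positive size;
-- a sum of ≥ 2 smaller blocks can be grouped into two such blocks).

IsPrimitive : {n : ℕ} → SqMat n → Set
IsPrimitive {n} A =
  ¬ (Σ ℕ λ p → Σ ℕ λ q → Σ (p + q ≡ n) λ e →
       Σ (SqMat p) λ B → Σ (SqMat q) λ C →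
         1 ≤ p × 1 ≤ q × (A ∼H subst SqMat e (B ⊕ C)))

HEquivHet : {m n : ℕ} → SqMat m → SqMat n → Set
HEquivHet {m} {n} A B = Σ (m ≡ n) λ e → subst SqMat e A ∼H B

-- The automorphism group Aut(A) = {(L,R) ∈ Mon(n)² : L A Rᵀ = A},
-- presented as a carrier, an equality, and its multiplication relation
-- (Mul x y z  means  z = x y, componentwise matrix product).

Aut : {n : ℕ} → SqMat n → Set
Aut {n} A = Σ (SqMat n × SqMat n) λ LR →
  IsMonomial (proj₁ LR) × IsMonomial (proj₂ LR) × (proj₁ LR · A · (proj₂ LR ᵀ) ≈M A)

_≈Aut_ : {n : ℕ} {A : SqMat n} → Aut A → Aut A → Set
((L , R) , _) ≈Aut ((L′ , R′) , _) = (L ≈M L′) × (R ≈M R′)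

MulAut : {n : ℕ} {A : SqMat n} → Aut A → Aut A → Aut A → Set
MulAut ((L , R) , _) ((L′ , R′) , _) ((L″ , R″) , _) =
  (L″ ≈M L · L′) × (R″ ≈M R · R′)

-- The product  ∏_t Aut(A_t) ≀ S_{r_t}.
-- Wreath product H ≀ S_r = H^r ⋊ S_r, with σ acting by (σ·h)(i) = h(σ⁻¹ i),
-- multiplication (h , σ)(h′ , σ′) = (h · (σ·h′) , σ ∘ σ′).

WreathProd : (s : ℕ) → (n r : Fin s → ℕ) → (A : (t : Fin s) → SqMat (n t)) → Set
WreathProd s n r A = (t : Fin s) → (Fin (r t) → Aut (A t)) × Permutation′ (r t)

_≈W_ : {s : ℕ} {n r : Fin s → ℕ} {A : (t : Fin s) → SqMat (n t)} →
       WreathProd s n r A → WreathProd s n r A → Set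
_≈W_ {r = r} x y = ∀ t →
    (∀ i → proj₁ (x t) i ≈Aut proj₁ (y t) i)
  × (∀ i → proj₂ (x t) ⟨$⟩ʳ i ≡ proj₂ (y t) ⟨$⟩ʳ i)

MulW : {s : ℕ} {n r : Fin s → ℕ} {A : (t : Fin s) → SqMat (n t)} →
       WreathProd s n r A → WreathProd s n r A → WreathProd s n r A → Set
MulW x y z = ∀ t →
    (∀ i → MulAut (proj₁ (x t) i) (proj₁ (y t) (proj₂ (x t) ⟨$⟩ˡ i)) (proj₁ (z t) i))
  × (∀ i → proj₂ (z t) ⟨$⟩ʳ i ≡ proj₂ (x t) ⟨$⟩ʳ (proj₂ (y t) ⟨$⟩ʳ i))

record IsGroupIso {G H : Set} (_≈G_ : G → G → Set) (_≈H_ : H → H → Set)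
                  (MulG : G → G → G → Set) (MulH : H → H → H → Set)
                  (φ : G → H) : Set where
  field
    cong-φ : ∀ x y → x ≈G y → φ x ≈H φ y
    injective : ∀ x y → φ x ≈H φ y → x ≈G y
    surjective : ∀ h → Σ G λ x → φ x ≈H h
    homomorphic : ∀ x y z → MulG x y z → MulH (φ x) (φ y) (φ z)

HasSize : {G : Set} → (G → G → Set) → ℕ → Set
HasSize {G} _≈_ N = Σ (Fin N → G) λ f →
  (∀ i j → f i ≈ f j → i ≡ j) × (∀ x → Σ (Fin N) λ i → f i ≈ x)

∏ : (s : ℕ) → (Fin s → ℕ) → ℕ
∏ zero    f = 1
∏ (suc s) f = f zero * ∏ s (λ t → f (suc t))

{-# OPTIONS --safe #-}
-- Monomial matrices are signed permutations, so an automorphism of A is a pair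
-- of signed permutations of its rows and columns preserving A, and H-equivalent
-- matrices have conjugate automorphism groups; hence A may be taken to be the
-- block diagonal matrix itself. Fix a block X and a block Y of it. The set S of
-- rows of X that an automorphism sends into Y and the set T of columns of X sent
-- into Y split X into S × T and its complement, up to zeros. Since rows of a
-- weighing matrix have squared norm k > 0 and columns at most k, S and T have
-- equally many elements, so X would be decomposable unless S and T are empty or
-- everything. Automorphisms therefore permute the blocks, necessarily among
-- H-equivalent ones, and restrict to automorphisms of the blocks.
module Submission where

open import Defs
open import Data.Nat using (ℕ; zero; suc; _+_; _*_; _^_; _≤_; _!; z≤n; s≤s)
import Data.Nat.Properties as ℕ
open import Data.Integer using (ℤ; +_; -_; 0ℤ; 1ℤ; -1ℤ) renaming (_+_ to _+ℤ_; _*_ to _*ℤ_; _≤_ to _≤ℤ_)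
open import Data.Integer using (Positive)
import Data.Integer as ℤ
import Data.Integer.Properties as ℤ
open import Data.Integer.Tactic.RingSolver using (solve-∀)
import Algebra.Properties.CommutativeSemigroup
open import Data.Bool as Bool using (Bool; true; false; not)
open import Data.Sign using (Sign) renaming (_*_ to _*ₛ_; + to ⊕₁; - to ⊖₁)
import Data.Sign.Properties as Sign
open import Data.Fin using (Fin; zero; suc; splitAt; join; _↑ˡ_; _↑ʳ_; combine; remQuot; punchIn; fromℕ<)
open import Data.Fin.Properties using (_≟_; splitAt-join; join-splitAt; splitAt-↑ˡ; splitAt-↑ʳ; remQuot-combine; combine-remQuot; punchIn-injective)
open import Data.Fin.Permutation using (Permutation′; permutation; _⟨$⟩ʳ_; _⟨$⟩ˡ_; inverseˡ; inverseʳ; ↔⇒≡; insert; remove; insert-remove; insert-punchIn; _≈_) renaming (id to idₚ)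
open import Data.Product using (Σ; _×_; _,_; proj₁; proj₂; uncurry)
open import Data.Product.Properties using (≡-dec)
open import Data.Sum as Sum using (_⊎_; inj₁; inj₂; [_,_]′)
open import Data.Empty using (⊥-elim)
open import Function using (_∘_; case_of_)
open import Relation.Binary.Definitions using (DecidableEquality)
open import Relation.Binary.PropositionalEquality using (_≡_; _≢_; refl; sym; trans; cong; cong₂; subst; module ≡-Reasoning)
open import Relation.Nullary using (¬_; yes; no; does)
open import Relation.Nullary.Decidable using (dec-true)
open ≡-Reasoning

-- Positivity of the weight cannot be dropped. The 2 by 2 zero matrix is the sum of two 1 by 1 zero
-- blocks, which are primitive, but its rows and columns move independently: it has 64
-- automorphisms, while the wreath product has 32. Positivity is assumed of `A` and handed on to
-- those blocks that occur in it. The bound on the columns stands in for the identity AᵀA = kI,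
-- whose usual proof divides by k. A one-sided bound suffices because it is applied twice: to S and
-- T it gives |S| ≤ |T|, to the complements it gives the reverse comparison, as both pairs fill up
-- the same n. The other obstacle is that an automorphism restricts to maps between different
-- blocks, whose sizes are not yet known to agree. Signed bijections between arbitrary sets
-- therefore replace square monomial matrices, and the block sum is re-indexed by triples of type,
-- copy and position.

private
  module ℤ+ = Algebra.Properties.CommutativeSemigroup ℤ.+-commutativeSemigroup
  module Sign* = Algebra.Properties.CommutativeSemigroup Sign.*-commutativeSemigroup

-- Finite sums

∑-cong : ∀ n {f g : Fin n → ℤ} → (∀ i → f i ≡ g i) → ∑ n f ≡ ∑ n g
∑-cong zero    f≗g = refl
∑-cong (suc n) f≗g = cong₂ _+ℤ_ (f≗g zero) (∑-cong n (f≗g ∘ suc))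

∑-zero : ∀ n {f : Fin n → ℤ} → (∀ i → f i ≡ 0ℤ) → ∑ n f ≡ 0ℤ
∑-zero zero    f≗0 = refl
∑-zero (suc n) f≗0 = cong₂ _+ℤ_ (f≗0 zero) (∑-zero n (f≗0 ∘ suc))

∑-single : ∀ n (f : Fin n → ℤ) i → (∀ j → i ≢ j → f j ≡ 0ℤ) → ∑ n f ≡ f i
∑-single (suc n) f zero    f≗0 =
  trans (cong (f zero +ℤ_) (∑-zero n (λ j → f≗0 (suc j) (λ ())))) (ℤ.+-identityʳ _)
∑-single (suc n) f (suc i) f≗0 =
  trans (cong₂ _+ℤ_ (f≗0 zero (λ ()))
                    (∑-single n (f ∘ suc) i (λ j i≢j → f≗0 (suc j) λ { refl → i≢j refl })))
        (ℤ.+-identityˡ _)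

∑-+ : ∀ n (f g : Fin n → ℤ) → ∑ n (λ i → f i +ℤ g i) ≡ ∑ n f +ℤ ∑ n g
∑-+ zero    f g = refl
∑-+ (suc n) f g = trans (cong (f zero +ℤ g zero +ℤ_) (∑-+ n (f ∘ suc) (g ∘ suc)))
                        (ℤ+.interchange (f zero) (g zero) _ _)

∑-*ˡ : ∀ n c (f : Fin n → ℤ) → ∑ n (λ i → c *ℤ f i) ≡ c *ℤ ∑ n f
∑-*ˡ zero    c f = sym (ℤ.*-zeroʳ c)
∑-*ˡ (suc n) c f = trans (cong (c *ℤ f zero +ℤ_) (∑-*ˡ n c (f ∘ suc)))
                         (sym (ℤ.*-distribˡ-+ c _ _))

∑-*ʳ : ∀ n (f : Fin n → ℤ) c → ∑ n (λ i → f i *ℤ c) ≡ ∑ n f *ℤ c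
∑-*ʳ n f c = begin
  ∑ n (λ i → f i *ℤ c)  ≡⟨ ∑-cong n (λ i → ℤ.*-comm (f i) c) ⟩
  ∑ n (λ i → c *ℤ f i)  ≡⟨ ∑-*ˡ n c f ⟩
  c *ℤ ∑ n f            ≡⟨ ℤ.*-comm c _ ⟩
  ∑ n f *ℤ c            ∎

∑-swap : ∀ m n (f : Fin m → Fin n → ℤ) →
         ∑ m (λ i → ∑ n (f i)) ≡ ∑ n (λ j → ∑ m (λ i → f i j))
∑-swap zero    n f = sym (∑-zero n (λ _ → refl))
∑-swap (suc m) n f = trans (cong (∑ n (f zero) +ℤ_) (∑-swap m n (f ∘ suc)))
                           (sym (∑-+ n (f zero) _))

∑-mono-≤ : ∀ n {f g : Fin n → ℤ} → (∀ i → f i ≤ℤ g i) → ∑ n f ≤ℤ ∑ n g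
∑-mono-≤ zero    f≤g = ℤ.≤-refl
∑-mono-≤ (suc n) f≤g = ℤ.+-mono-≤ (f≤g zero) (∑-mono-≤ n (f≤g ∘ suc))

∑-nonneg : ∀ n {f : Fin n → ℤ} → (∀ i → 0ℤ ≤ℤ f i) → 0ℤ ≤ℤ ∑ n f
∑-nonneg zero    0≤f = ℤ.≤-refl
∑-nonneg (suc n) 0≤f = ℤ.+-mono-≤ (0≤f zero) (∑-nonneg n (0≤f ∘ suc))

term≤∑ : ∀ n {f : Fin n → ℤ} → (∀ i → 0ℤ ≤ℤ f i) → ∀ i → f i ≤ℤ ∑ n f
term≤∑ (suc n) {f} 0≤f zero    =
  subst (_≤ℤ ∑ (suc n) f) (ℤ.+-identityʳ _) (ℤ.+-monoʳ-≤ (f zero) (∑-nonneg n (0≤f ∘ suc)))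
term≤∑ (suc n) {f} 0≤f (suc i) =
  subst (_≤ℤ ∑ (suc n) f) (ℤ.+-identityˡ _) (ℤ.+-mono-≤ (0≤f zero) (term≤∑ n (0≤f ∘ suc) i))

0≤i*i : ∀ i → 0ℤ ≤ℤ i *ℤ i
0≤i*i (+ n)        = subst (0ℤ ≤ℤ_) (ℤ.pos-* n n) (ℤ.+≤+ z≤n)
0≤i*i ℤ.-[1+ n ] = ℤ.+≤+ z≤n

-- Signed bijections

infixr 8 _•_

_•_ : Sign → ℤ → ℤ
⊕₁ • z = z
⊖₁ • z = - z

•-assoc : ∀ s t z → (s *ₛ t) • z ≡ s • (t • z)
•-assoc ⊕₁ t  z = refl
•-assoc ⊖₁ ⊕₁ z = refl
•-assoc ⊖₁ ⊖₁ z = sym (ℤ.neg-involutive z)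

•-zero : ∀ s → s • 0ℤ ≡ 0ℤ
•-zero ⊕₁ = refl
•-zero ⊖₁ = refl

•-* : ∀ s z w → (s • z) *ℤ w ≡ s • (z *ℤ w)
•-* ⊕₁ z w = refl
•-* ⊖₁ z w = sym (ℤ.neg-distribˡ-* z w)

•1-injective : ∀ s t → s • 1ℤ ≡ t • 1ℤ → s ≡ t
•1-injective ⊕₁ ⊕₁ _ = refl
•1-injective ⊖₁ ⊖₁ _ = refl

•1≢0 : ∀ s → s • 1ℤ ≢ 0ℤ
•1≢0 ⊕₁ ()
•1≢0 ⊖₁ ()

-- Encodes a monomial matrix whose row `i` has its nonzero entry, of sign `sgn i`, in column `to i`.
-- Source and target may differ, so that re-indexings and maps from one block onto another have the
-- same form.
record SignedBij (I J : Set) : Set where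
  field
    to      : I → J
    from    : J → I
    sgn     : I → Sign
    from-to : ∀ i → from (to i) ≡ i
    to-from : ∀ j → to (from j) ≡ j

open SignedBij

infix 4 _≈S_
infixl 7 _⨾_

record _≈S_ {I J : Set} (x y : SignedBij I J) : Set where
  constructor mk≈
  field
    to-≡  : ∀ i → to x i ≡ to y i
    sgn-≡ : ∀ i → sgn x i ≡ sgn y i

open _≈S_

-- The order is that of the matrix product: a row of `L · M` is followed through `L` and then
-- through `M`.
_⨾_ : ∀ {I J K} → SignedBij I J → SignedBij J K → SignedBij I K
x ⨾ y = record
  { to      = to y ∘ to x
  ; from    = from x ∘ from y
  ; sgn     = λ i → sgn x i *ₛ sgn y (to x i)
  ; from-to = λ i → trans (cong (from x) (from-to y _)) (from-to x i)
  ; to-from = λ j → trans (cong (to y) (to-from x _)) (to-from y j)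
  }

inv : ∀ {I J} → SignedBij I J → SignedBij J I
inv x = record
  { to = from x ; from = to x ; sgn = sgn x ∘ from x
  ; from-to = to-from x ; to-from = from-to x }

unsigned : ∀ {I J} (f : I → J) (g : J → I) →
           (∀ i → g (f i) ≡ i) → (∀ j → f (g j) ≡ j) → SignedBij I J
unsigned f g gf fg = record
  { to = f ; from = g ; sgn = λ _ → ⊕₁ ; from-to = gf ; to-from = fg }

≈S-refl : ∀ {I J} {x : SignedBij I J} → x ≈S x
≈S-refl = mk≈ (λ _ → refl) (λ _ → refl)

≈S-sym : ∀ {I J} {x y : SignedBij I J} → x ≈S y → y ≈S x
≈S-sym (mk≈ p q) = mk≈ (sym ∘ p) (sym ∘ q)

≈S-trans : ∀ {I J} {x y z : SignedBij I J} → x ≈S y → y ≈S z → x ≈S z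
≈S-trans (mk≈ p q) (mk≈ p′ q′) = mk≈ (λ i → trans (p i) (p′ i)) (λ i → trans (q i) (q′ i))

⨾-cong : ∀ {I J K} {x x′ : SignedBij I J} {y y′ : SignedBij J K} →
         x ≈S x′ → y ≈S y′ → x ⨾ y ≈S x′ ⨾ y′
⨾-cong {y′ = y′} (mk≈ p q) (mk≈ p′ q′) = mk≈
  (λ i → trans (p′ _) (cong (to y′) (p i)))
  (λ i → cong₂ _*ₛ_ (q i) (trans (q′ _) (cong (sgn y′) (p i))))

from-cong : ∀ {I J} {x y : SignedBij I J} → x ≈S y → ∀ j → from x j ≡ from y j
from-cong {x = x} {y} (mk≈ p _) j =
  trans (cong (from x) (trans (sym (to-from y j)) (sym (p _)))) (from-to x _)

-- Conjugation by a signed bijection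

conj : ∀ {I J} → SignedBij I J → SignedBij J J → SignedBij I I
conj p x = p ⨾ x ⨾ inv p

private
  cancel-middle : ∀ a b c → a *ₛ b *ₛ (b *ₛ c) ≡ a *ₛ c
  cancel-middle a ⊕₁ c = cong (_*ₛ c) (Sign.*-identityʳ a)
  cancel-middle ⊕₁ ⊖₁ c = Sign.opposite-involutive c
  cancel-middle ⊖₁ ⊖₁ c = refl

  cancel-outer : ∀ a b c → a *ₛ (a *ₛ b *ₛ c) *ₛ c ≡ b
  cancel-outer a b c = begin
    a *ₛ (a *ₛ b *ₛ c) *ₛ c    ≡⟨ cong (λ d → a *ₛ d *ₛ c) (Sign.*-assoc a b c) ⟩
    a *ₛ (a *ₛ (b *ₛ c)) *ₛ c  ≡⟨ cong (_*ₛ c) (sym (Sign.*-assoc a a (b *ₛ c))) ⟩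
    a *ₛ a *ₛ (b *ₛ c) *ₛ c    ≡⟨ cong (λ d → d *ₛ (b *ₛ c) *ₛ c) (Sign.s*s≡+ a) ⟩
    b *ₛ c *ₛ c                ≡⟨ Sign.*-assoc b c c ⟩
    b *ₛ (c *ₛ c)              ≡⟨ cong (b *ₛ_) (Sign.s*s≡+ c) ⟩
    b *ₛ ⊕₁                    ≡⟨ Sign.*-identityʳ b ⟩
    b                          ∎

-- On the right the path runs through `inv p` and back through `p`. This detour ends at the index
-- where it began and contributes one sign of `p` twice, which `cancel-middle` removes.
conj-⨾ : ∀ {I J} (p : SignedBij I J) x y → conj p (x ⨾ y) ≈S conj p x ⨾ conj p y
conj-⨾ p x y = mk≈
  (λ i → cong (from p ∘ to y) (sym (to-from p _)))
  λ i → begin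
    sgn p i *ₛ (sgn x (to p i) *ₛ sgn y (to x (to p i))) *ₛ sgn p (from p (to y (to x (to p i))))
      ≡⟨ cong (_*ₛ sgn p (from p (to y (to x (to p i))))) (sym (Sign.*-assoc (sgn p i) _ _)) ⟩
    sgn p i *ₛ sgn x (to p i) *ₛ sgn y (to x (to p i)) *ₛ sgn p (from p (to y (to x (to p i))))
      ≡⟨ Sign.*-assoc (sgn p i *ₛ sgn x (to p i)) _ _ ⟩
    sgn p i *ₛ sgn x (to p i) *ₛ (sgn y (to x (to p i)) *ₛ sgn p (from p (to y (to x (to p i)))))
      ≡⟨ cong (λ j → sgn p i *ₛ sgn x (to p i) *ₛ (sgn y j *ₛ sgn p (from p (to y j))))
              (sym (to-from p _)) ⟩
    sgn p i *ₛ sgn x (to p i) *ₛ (sgn y (j i) *ₛ sgn p (from p (to y (j i))))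
      ≡⟨ sym (cancel-middle (sgn p i *ₛ sgn x (to p i)) (sgn p (from p (to x (to p i)))) _) ⟩
    sgn p i *ₛ sgn x (to p i) *ₛ sgn p (from p (to x (to p i))) *ₛ
      (sgn p (from p (to x (to p i))) *ₛ (sgn y (j i) *ₛ sgn p (from p (to y (j i)))))
      ≡⟨ cong (sgn p i *ₛ sgn x (to p i) *ₛ sgn p (from p (to x (to p i))) *ₛ_)
              (sym (Sign.*-assoc (sgn p (from p (to x (to p i)))) _ _)) ⟩
    _ ∎
  where
  j = λ i → to p (from p (to x (to p i)))

conj-inverseˡ : ∀ {I J} (p : SignedBij I J) x → conj p (conj (inv p) x) ≈S x
conj-inverseˡ p x = mk≈
  (λ i → trans (from-to p _) (cong (to x) (from-to p i)))
  (λ i → begin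
    sgn p i *ₛ (sgn p (from p (to p i)) *ₛ sgn x (from p (to p i)) *ₛ sgn p (from p (k i)))
      *ₛ sgn p (from p (k i))
      ≡⟨ cong (λ i′ → sgn p i *ₛ (sgn p i′ *ₛ sgn x i′ *ₛ sgn p (from p (k i))) *ₛ sgn p (from p (k i)))
              (from-to p i) ⟩
    sgn p i *ₛ (sgn p i *ₛ sgn x i *ₛ sgn p (from p (k i))) *ₛ sgn p (from p (k i))
      ≡⟨ cancel-outer (sgn p i) (sgn x i) _ ⟩
    sgn x i ∎)
  where
  k = λ i → to p (to x (from p (to p i)))

conj-inverseʳ : ∀ {I J} (p : SignedBij I J) x → conj (inv p) (conj p x) ≈S x
conj-inverseʳ p x = mk≈
  (λ j → trans (to-from p _) (cong (to x) (to-from p j)))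
  (λ j → begin
    sgn p (from p j) *ₛ (sgn p (from p j) *ₛ sgn x (to p (from p j)) *ₛ sgn p (k j))
      *ₛ sgn p (from p (to p (k j)))
      ≡⟨ cong (λ i → sgn p (from p j) *ₛ (sgn p (from p j) *ₛ sgn x (to p (from p j)) *ₛ sgn p (k j)) *ₛ sgn p i)
              (from-to p (k j)) ⟩
    sgn p (from p j) *ₛ (sgn p (from p j) *ₛ sgn x (to p (from p j)) *ₛ sgn p (k j)) *ₛ sgn p (k j)
      ≡⟨ cancel-outer (sgn p (from p j)) _ _ ⟩
    sgn x (to p (from p j))
      ≡⟨ cong (sgn x) (to-from p j) ⟩
    sgn x j ∎)
  where
  k = λ j → from p (to x (to p (from p j)))

conj-cong : ∀ {I J} (p : SignedBij I J) {x y} → x ≈S y → conj p x ≈S conj p y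
conj-cong p x≈y = ⨾-cong (⨾-cong (≈S-refl {x = p}) x≈y) (≈S-refl {x = inv p})

-- Carries x y M N plays the role of the equation L N Rᵀ = M.
record Carries {I J I′ J′ : Set} (x : SignedBij I I′) (y : SignedBij J J′)
               (M : I → J → ℤ) (N : I′ → J′ → ℤ) : Set where
  constructor mkCarries
  field
    entry : ∀ i j → (sgn x i *ₛ sgn y j) • N (to x i) (to y j) ≡ M i j

open Carries

Carries-⨾ : ∀ {I J I′ J′ I″ J″ : Set}
            {x : SignedBij I I′} {y : SignedBij J J′} {x′ : SignedBij I′ I″} {y′ : SignedBij J′ J″}
            {M : I → J → ℤ} {N : I′ → J′ → ℤ} {P : I″ → J″ → ℤ} →
            Carries x y M N → Carries x′ y′ N P → Carries (x ⨾ x′) (y ⨾ y′) M P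
Carries-⨾ {x = x} {y} {x′} {y′} {M} {N} {P} (mkCarries c) (mkCarries c′) = mkCarries λ i j → begin
  (sgn x i *ₛ sgn x′ (to x i) *ₛ (sgn y j *ₛ sgn y′ (to y j))) • P _ _
    ≡⟨ cong (_• P _ _) (Sign*.interchange (sgn x i) (sgn x′ (to x i)) (sgn y j) (sgn y′ (to y j))) ⟩
  (sgn x i *ₛ sgn y j *ₛ (sgn x′ (to x i) *ₛ sgn y′ (to y j))) • P _ _
    ≡⟨ •-assoc (sgn x i *ₛ sgn y j) _ _ ⟩
  (sgn x i *ₛ sgn y j) • (sgn x′ (to x i) *ₛ sgn y′ (to y j)) • P _ _
    ≡⟨ cong ((sgn x i *ₛ sgn y j) •_) (c′ _ _) ⟩
  (sgn x i *ₛ sgn y j) • N _ _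
    ≡⟨ c i j ⟩
  M i j ∎

Carries-inv : ∀ {I J I′ J′ : Set} {x : SignedBij I I′} {y : SignedBij J J′}
              {M : I → J → ℤ} {N : I′ → J′ → ℤ} → Carries x y M N → Carries (inv x) (inv y) N M
Carries-inv {x = x} {y} {M} {N} (mkCarries c) = mkCarries λ i j → begin
  s i j • M (from x i) (from y j)                          ≡⟨ cong (s i j •_) (sym (c _ _)) ⟩
  s i j • s i j • N (to x (from x i)) (to y (from y j))    ≡⟨ sym (•-assoc (s i j) (s i j) _) ⟩
  (s i j *ₛ s i j) • N (to x (from x i)) (to y (from y j)) ≡⟨ cong (_• N _ _) (Sign.s*s≡+ (s i j)) ⟩
  N (to x (from x i)) (to y (from y j))                    ≡⟨ cong₂ N (to-from x i) (to-from y j) ⟩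
  N i j ∎
  where
  s = λ i j → sgn x (from x i) *ₛ sgn y (from y j)

-- Monomial matrices as signed bijections

-- Matrices are compared only entrywise, so the correspondence is a relation. It treats given
-- matrices and those built by `monomialMatrix` alike, and is one-to-one up to `≈S` and `≈M`.
record Represents {n} (x : SignedBij (Fin n) (Fin n)) (L : SqMat n) : Set where
  constructor mkRepresents
  field
    on-graph  : ∀ i → L i (to x i) ≡ sgn x i • 1ℤ
    off-graph : ∀ i j → to x i ≢ j → L i j ≡ 0ℤ

monomialMatrix : ∀ {n} → SignedBij (Fin n) (Fin n) → SqMat n
monomialMatrix x i j with to x i ≟ j
... | yes _ = sgn x i • 1ℤ
... | no  _ = 0ℤ

monomialMatrix-represents : ∀ {n} (x : SignedBij (Fin n) (Fin n)) → Represents x (monomialMatrix x)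
monomialMatrix-represents x = mkRepresents on off
  where
  on : ∀ i → monomialMatrix x i (to x i) ≡ sgn x i • 1ℤ
  on i with to x i ≟ to x i
  ... | yes _  = refl
  ... | no x≢x = ⊥-elim (x≢x refl)
  off : ∀ i j → to x i ≢ j → monomialMatrix x i j ≡ 0ℤ
  off i j x≢j with to x i ≟ j
  ... | yes x≡j = ⊥-elim (x≢j x≡j)
  ... | no _    = refl

represents⇒monomial : ∀ {n} {x : SignedBij (Fin n) (Fin n)} {L} → Represents x L → IsMonomial L
represents⇒monomial {n} {x} {L} (mkRepresents on off) = entries , rows , columns
  where
  support : ∀ i j → L i j ≢ 0ℤ → to x i ≡ j
  support i j Lij≢0 with to x i ≟ j
  ... | yes eq = eq
  ... | no neq = ⊥-elim (Lij≢0 (off i j neq))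
  unit : ∀ s → (s • 1ℤ ≡ 0ℤ) ⊎ (s • 1ℤ ≡ 1ℤ) ⊎ (s • 1ℤ ≡ -1ℤ)
  unit ⊕₁ = inj₂ (inj₁ refl)
  unit ⊖₁ = inj₂ (inj₂ refl)
  entries : ∀ i j → (L i j ≡ 0ℤ) ⊎ (L i j ≡ 1ℤ) ⊎ (L i j ≡ -1ℤ)
  entries i j with to x i ≟ j
  ... | yes refl rewrite on i = unit (sgn x i)
  ... | no neq = inj₁ (off i j neq)
  nonzero : ∀ i → L i (to x i) ≢ 0ℤ
  nonzero i eq = •1≢0 (sgn x i) (trans (sym (on i)) eq)
  rows : ∀ i → Σ (Fin n) λ j → (L i j ≢ 0ℤ) × (∀ j′ → L i j′ ≢ 0ℤ → j′ ≡ j)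
  rows i = to x i , nonzero i , λ j′ ne → sym (support i j′ ne)
  columns : ∀ j → Σ (Fin n) λ i → (L i j ≢ 0ℤ) × (∀ i′ → L i′ j ≢ 0ℤ → i′ ≡ i)
  columns j = from x j , subst (λ k → L (from x j) k ≢ 0ℤ) (to-from x j) (nonzero (from x j)) ,
    λ i′ ne → trans (sym (from-to x i′)) (cong (from x) (support i′ j ne))

-- The row clause supplies `to` and the column clause `from`. They are inverse because the nonzero
-- entry chosen in a row is also the only one in its column, and conversely.
monomial⇒signedBij : ∀ {n} {L : SqMat n} → IsMonomial L → Σ (SignedBij (Fin n) (Fin n)) λ x → Represents x L
monomial⇒signedBij {n} {L} (entries , rows , columns) = x , mkRepresents on off
  where
  σ = proj₁ ∘ rows
  σ⁻¹ = proj₁ ∘ columns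
  sign : ∀ i → Σ Sign λ s → L i (σ i) ≡ s • 1ℤ
  sign i with entries i (σ i)
  ... | inj₁ ≡0         = ⊥-elim (proj₁ (proj₂ (rows i)) ≡0)
  ... | inj₂ (inj₁ ≡1)  = ⊕₁ , ≡1
  ... | inj₂ (inj₂ ≡-1) = ⊖₁ , ≡-1
  x : SignedBij (Fin n) (Fin n)
  x = record
    { to      = σ
    ; from    = σ⁻¹
    ; sgn     = proj₁ ∘ sign
    ; from-to = λ i → sym (proj₂ (proj₂ (columns (σ i))) i (proj₁ (proj₂ (rows i))))
    ; to-from = λ j → sym (proj₂ (proj₂ (rows (σ⁻¹ j))) j (proj₁ (proj₂ (columns j))))
    }
  on = proj₂ ∘ sign
  off : ∀ i j → σ i ≢ j → L i j ≡ 0ℤ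
  off i j ne with L i j ℤ.≟ 0ℤ
  ... | yes eq = eq
  ... | no neq = ⊥-elim (ne (sym (proj₂ (proj₂ (rows i)) j neq)))

Represents-resp : ∀ {n} {x y : SignedBij (Fin n) (Fin n)} {L M : SqMat n} →
                  Represents x L → Represents y M → x ≈S y → L ≈M M
Represents-resp {x = x} {y} {L} {M} (mkRepresents d o) (mkRepresents d′ o′) (mk≈ p q) i j with to x i ≟ j
... | yes refl = begin
  L i (to x i)    ≡⟨ d i ⟩
  sgn x i • 1ℤ    ≡⟨ cong (_• 1ℤ) (q i) ⟩
  sgn y i • 1ℤ    ≡⟨ sym (d′ i) ⟩
  M i (to y i)    ≡⟨ cong (M i) (sym (p i)) ⟩
  M i (to x i)    ∎
... | no ne = trans (o i j ne) (sym (o′ i j (ne ∘ trans (p i))))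

Represents-unique : ∀ {n} {x y : SignedBij (Fin n) (Fin n)} {L M : SqMat n} →
                    Represents x L → Represents y M → L ≈M M → x ≈S y
Represents-unique {x = x} {y} {L} {M} (mkRepresents d o) (mkRepresents d′ o′) L≈M = mk≈ to-eq λ i →
  •1-injective _ _ (begin
    sgn x i • 1ℤ    ≡⟨ sym (d i) ⟩
    L i (to x i)    ≡⟨ L≈M i _ ⟩
    M i (to x i)    ≡⟨ cong (M i) (to-eq i) ⟩
    M i (to y i)    ≡⟨ d′ i ⟩
    sgn y i • 1ℤ    ∎)
  where
  to-eq : ∀ i → to x i ≡ to y i
  to-eq i with to y i ≟ to x i
  ... | yes eq = sym eq
  ... | no ne  = ⊥-elim (•1≢0 (sgn x i) (trans (sym (d i)) (trans (L≈M i _) (o′ i _ ne))))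

row-· : ∀ {n p} {x : SignedBij (Fin n) (Fin n)} {L : SqMat n} → Represents x L →
        ∀ (M : Mat n p) i j → (L · M) i j ≡ sgn x i • M (to x i) j
row-· {n} {x = x} {L} (mkRepresents d o) M i j = begin
  ∑ n (λ k → L i k *ℤ M k j)
    ≡⟨ ∑-single n _ (to x i) (λ k ne → cong (_*ℤ M k j) (o i k ne)) ⟩
  L i (to x i) *ℤ M (to x i) j      ≡⟨ cong (_*ℤ M (to x i) j) (d i) ⟩
  (sgn x i • 1ℤ) *ℤ M (to x i) j    ≡⟨ •-* (sgn x i) 1ℤ _ ⟩
  sgn x i • (1ℤ *ℤ M (to x i) j)    ≡⟨ cong (sgn x i •_) (ℤ.*-identityˡ _) ⟩
  sgn x i • M (to x i) j            ∎

column-· : ∀ {m n} {y : SignedBij (Fin n) (Fin n)} {R : SqMat n} → Represents y R →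
           ∀ (M : Mat m n) i j → (M · (R ᵀ)) i j ≡ sgn y j • M i (to y j)
column-· {n = n} rep M i j =
  trans (∑-cong n (λ k → ℤ.*-comm (M i k) _)) (row-· rep (M ᵀ) j i)

Represents-⨾ : ∀ {n} {x y : SignedBij (Fin n) (Fin n)} {L M : SqMat n} →
               Represents x L → Represents y M → Represents (x ⨾ y) (L · M)
Represents-⨾ {x = x} {y} {L} {M} rx (mkRepresents d o) = mkRepresents
  (λ i → begin
    (L · M) i (to y (to x i))              ≡⟨ row-· rx M i _ ⟩
    sgn x i • M (to x i) (to y (to x i))   ≡⟨ cong (sgn x i •_) (d (to x i)) ⟩
    sgn x i • sgn y (to x i) • 1ℤ          ≡⟨ sym (•-assoc (sgn x i) _ _) ⟩
    (sgn x i *ₛ sgn y (to x i)) • 1ℤ       ∎)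
  (λ i j ne → trans (row-· rx M i j) (trans (cong (sgn x i •_) (o _ j ne)) (•-zero (sgn x i))))

entry-LARᵀ : ∀ {n} {x y : SignedBij (Fin n) (Fin n)} {L R : SqMat n} →
             Represents x L → Represents y R → ∀ (A : SqMat n) i j →
             (L · A · (R ᵀ)) i j ≡ (sgn x i *ₛ sgn y j) • A (to x i) (to y j)
entry-LARᵀ {x = x} {y} {L} {R} rx ry A i j = begin
  (L · A · (R ᵀ)) i j                           ≡⟨ column-· ry (L · A) i j ⟩
  sgn y j • (L · A) i (to y j)                  ≡⟨ cong (sgn y j •_) (row-· rx A i _) ⟩
  sgn y j • sgn x i • A (to x i) (to y j)       ≡⟨ sym (•-assoc (sgn y j) _ _) ⟩
  (sgn y j *ₛ sgn x i) • A (to x i) (to y j)    ≡⟨ cong (_• A _ _) (Sign.*-comm (sgn y j) (sgn x i)) ⟩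
  (sgn x i *ₛ sgn y j) • A (to x i) (to y j)    ∎

∼H⇒Carries : ∀ {n} {A B : SqMat n} → A ∼H B →
             Σ (SignedBij (Fin n) (Fin n)) λ x → Σ (SignedBij (Fin n) (Fin n)) λ y → Carries x y B A
∼H⇒Carries {A = A} (L , R , mL , mR , eq) =
  let x , rx = monomial⇒signedBij mL
      y , ry = monomial⇒signedBij mR
  in x , y , mkCarries λ i j → trans (sym (entry-LARᵀ rx ry A i j)) (eq i j)

Carries⇒∼H : ∀ {n} {A B : SqMat n} {x y : SignedBij (Fin n) (Fin n)} → Carries x y B A → A ∼H B
Carries⇒∼H {A = A} {x = x} {y} (mkCarries c) =
  monomialMatrix x , monomialMatrix y ,
  represents⇒monomial rx , represents⇒monomial ry ,
  λ i j → trans (entry-LARᵀ rx ry A i j) (c i j)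
  where
  rx = monomialMatrix-represents x
  ry = monomialMatrix-represents y

-- Zero blocks of weighing matrices

scalarI-diagonal : ∀ n k i → scalarI n k i i ≡ k
scalarI-diagonal n k i with i ≟ i
... | yes _  = refl
... | no i≢i = ⊥-elim (i≢i refl)

scalarI-offDiagonal : ∀ n k i j → i ≢ j → scalarI n k i j ≡ 0ℤ
scalarI-offDiagonal n k i j i≢j with i ≟ j
... | yes i≡j = ⊥-elim (i≢j i≡j)
... | no _    = refl

rowNorm : ∀ {n} {k} {A : SqMat n} → IsWeighingOfWeight k A → ∀ i → ∑ n (λ j → A i j *ℤ A i j) ≡ k
rowNorm {n} {k} w i = trans (w i i) (scalarI-diagonal n k i)

-- With u = AᵀA eⱼ and c the squared norm of column j, c² = uⱼ² ≤ ‖u‖² = k c.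
columnNorm≤ : ∀ {n} {k} {A : SqMat n} → 0ℤ ≤ℤ k → IsWeighingOfWeight k A →
              ∀ j → ∑ n (λ i → A i j *ℤ A i j) ≤ℤ k
columnNorm≤ {n} {k} {A} 0≤k w j = bound c (∑-nonneg n (λ i → 0≤i*i (A i j))) c*c≤k*c
  where
  c : ℤ
  c = ∑ n (λ i → A i j *ℤ A i j)
  u : Fin n → ℤ
  u l = ∑ n (λ i → A i j *ℤ A i l)

  -- In matrix form, `A u = (A Aᵀ) A eⱼ = k A eⱼ`.
  inner : ∀ i → ∑ n (λ l → A i l *ℤ u l) ≡ k *ℤ A i j
  inner i = begin
    ∑ n (λ l → A i l *ℤ u l)
      ≡⟨ ∑-cong n (λ l → sym (∑-*ˡ n (A i l) _)) ⟩
    ∑ n (λ l → ∑ n (λ i′ → A i l *ℤ (A i′ j *ℤ A i′ l)))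
      ≡⟨ ∑-swap n n _ ⟩
    ∑ n (λ i′ → ∑ n (λ l → A i l *ℤ (A i′ j *ℤ A i′ l)))
      ≡⟨ ∑-cong n (λ i′ → ∑-cong n (λ l → rearrange (A i l) (A i′ j) (A i′ l))) ⟩
    ∑ n (λ i′ → ∑ n (λ l → A i l *ℤ A i′ l *ℤ A i′ j))
      ≡⟨ ∑-cong n (λ i′ → trans (∑-*ʳ n _ (A i′ j)) (cong (_*ℤ A i′ j) (w i i′))) ⟩
    ∑ n (λ i′ → scalarI n k i i′ *ℤ A i′ j)
      ≡⟨ ∑-single n _ i (λ i′ i≢i′ → cong (_*ℤ A i′ j) (scalarI-offDiagonal n k i i′ i≢i′)) ⟩
    scalarI n k i i *ℤ A i j
      ≡⟨ cong (_*ℤ A i j) (scalarI-diagonal n k i) ⟩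
    k *ℤ A i j ∎
    where
    rearrange : ∀ a b d → a *ℤ (b *ℤ d) ≡ a *ℤ d *ℤ b
    rearrange = solve-∀

  -- Moving `Aᵀ` across the scalar product, `u · u = (A eⱼ) · (A u)`, to which `inner` applies.
  ‖u‖² : ∑ n (λ l → u l *ℤ u l) ≡ k *ℤ c
  ‖u‖² = begin
    ∑ n (λ l → u l *ℤ u l)
      ≡⟨ ∑-cong n (λ l → sym (∑-*ʳ n _ (u l))) ⟩
    ∑ n (λ l → ∑ n (λ i → A i j *ℤ A i l *ℤ u l))
      ≡⟨ ∑-swap n n _ ⟩
    ∑ n (λ i → ∑ n (λ l → A i j *ℤ A i l *ℤ u l))
      ≡⟨ ∑-cong n (λ i → trans (∑-cong n (λ l → ℤ.*-assoc (A i j) (A i l) (u l))) (∑-*ˡ n (A i j) _)) ⟩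
    ∑ n (λ i → A i j *ℤ ∑ n (λ l → A i l *ℤ u l))
      ≡⟨ ∑-cong n (λ i → cong (A i j *ℤ_) (inner i)) ⟩
    ∑ n (λ i → A i j *ℤ (k *ℤ A i j))
      ≡⟨ ∑-cong n (λ i → rearrange (A i j) k) ⟩
    ∑ n (λ i → k *ℤ (A i j *ℤ A i j))
      ≡⟨ ∑-*ˡ n k _ ⟩
    k *ℤ c ∎
    where
    rearrange : ∀ a k → a *ℤ (k *ℤ a) ≡ k *ℤ (a *ℤ a)
    rearrange = solve-∀

  c*c≤k*c : c *ℤ c ≤ℤ k *ℤ c
  c*c≤k*c = subst (c *ℤ c ≤ℤ_) ‖u‖² (term≤∑ n (λ l → 0≤i*i (u l)) j)

  -- A factor `c` can be cancelled only when it is positive; for `c = 0` the claim is the hypothesis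
  -- `0 ≤ k`.
  bound : ∀ c → 0ℤ ≤ℤ c → c *ℤ c ≤ℤ k *ℤ c → c ≤ℤ k
  bound (+ zero)    _ _  = 0≤k
  bound ℤ.+[1+ m ]  _ le = ℤ.*-cancelʳ-≤-pos _ k ℤ.+[1+ m ] le

indicator : Bool → ℤ
indicator true  = 1ℤ
indicator false = 0ℤ

-- The sizes are recorded in two forms: the indicator sums enter the double count over ℤ, and `size`
-- becomes the equation demanded by `IsPrimitive`.
record Partition {n} (S : Fin n → Bool) (p q : ℕ) : Set where
  field
    classify   : Fin n → Fin p ⊎ Fin q
    element    : Fin p ⊎ Fin q → Fin n
    element-classify : ∀ i → element (classify i) ≡ i
    classify-element : ∀ c → classify (element c) ≡ c
    inside     : ∀ a → S (element (inj₁ a)) ≡ true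
    outside    : ∀ b → S (element (inj₂ b)) ≡ false
    size       : p + q ≡ n
    ∑-inside   : ∑ n (λ i → indicator (S i)) ≡ + p
    ∑-outside  : ∑ n (λ i → indicator (not (S i))) ≡ + q

partition : ∀ {n} (S : Fin n → Bool) → Σ ℕ λ p → Σ ℕ λ q → Partition S p q
partition {zero} S = 0 , 0 , record
  { classify = λ () ; element = λ { (inj₁ ()) ; (inj₂ ()) }
  ; element-classify = λ () ; classify-element = λ { (inj₁ ()) ; (inj₂ ()) }
  ; inside = λ () ; outside = λ () ; size = refl ; ∑-inside = refl ; ∑-outside = refl }
partition {suc n} S with partition (S ∘ suc) | S zero in S0
... | p , q , P | true = suc p , q , record
  { classify = classify′ ; element = element′
  ; element-classify = ec ; classify-element = ce
  ; inside = λ { zero → S0 ; (suc a) → inside a } ; outside = outside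
  ; size = cong suc size
  ; ∑-inside = cong₂ _+ℤ_ (cong indicator S0) ∑-inside
  ; ∑-outside = cong₂ _+ℤ_ (cong (indicator ∘ not) S0) ∑-outside }
  where
  open Partition P
  classify′ : Fin (suc n) → Fin (suc p) ⊎ Fin q
  classify′ zero    = inj₁ zero
  classify′ (suc i) = Sum.map₁ suc (classify i)
  element′ : Fin (suc p) ⊎ Fin q → Fin (suc n)
  element′ (inj₁ zero)    = zero
  element′ (inj₁ (suc a)) = suc (element (inj₁ a))
  element′ (inj₂ b)       = suc (element (inj₂ b))
  ec : ∀ i → element′ (classify′ i) ≡ i
  ec zero = refl
  ec (suc i) with classify i | element-classify i
  ... | inj₁ a | eq = cong suc eq
  ... | inj₂ b | eq = cong suc eq
  ce : ∀ c → classify′ (element′ c) ≡ c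
  ce (inj₁ zero)    = refl
  ce (inj₁ (suc a)) = cong (Sum.map₁ suc) (classify-element (inj₁ a))
  ce (inj₂ b)       = cong (Sum.map₁ suc) (classify-element (inj₂ b))
... | p , q , P | false = p , suc q , record
  { classify = classify′ ; element = element′
  ; element-classify = ec ; classify-element = ce
  ; inside = inside ; outside = λ { zero → S0 ; (suc b) → outside b }
  ; size = trans (ℕ.+-suc p q) (cong suc size)
  ; ∑-inside = cong₂ _+ℤ_ (cong indicator S0) ∑-inside
  ; ∑-outside = cong₂ _+ℤ_ (cong (indicator ∘ not) S0) ∑-outside }
  where
  open Partition P
  classify′ : Fin (suc n) → Fin p ⊎ Fin (suc q)
  classify′ zero    = inj₂ zero
  classify′ (suc i) = Sum.map₂ suc (classify i)
  element′ : Fin p ⊎ Fin (suc q) → Fin (suc n)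
  element′ (inj₂ zero)    = zero
  element′ (inj₁ a)       = suc (element (inj₁ a))
  element′ (inj₂ (suc b)) = suc (element (inj₂ b))
  ec : ∀ i → element′ (classify′ i) ≡ i
  ec zero = refl
  ec (suc i) with classify i | element-classify i
  ... | inj₁ a | eq = cong suc eq
  ... | inj₂ b | eq = cong suc eq
  ce : ∀ c → classify′ (element′ c) ≡ c
  ce (inj₂ zero)    = refl
  ce (inj₁ a)       = cong (Sum.map₂ suc) (classify-element (inj₁ a))
  ce (inj₂ (suc b)) = cong (Sum.map₂ suc) (classify-element (inj₂ b))

IsPosWeighing : ∀ {n} → SqMat n → Set
IsPosWeighing A = Σ ℤ λ k → Positive k × IsWeighingOfWeight k A

-- Double counting the squares of the entries in the rows S: each row
-- contributes k, and each column of T at most k.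
count-rows≤columns : ∀ {n} {A : SqMat n} → IsPosWeighing A → (S T : Fin n → Bool) →
                     (∀ i j → S i ≢ T j → A i j ≡ 0ℤ) → ∀ {p p′} →
                     ∑ n (λ i → indicator (S i)) ≡ + p → ∑ n (λ j → indicator (T j)) ≡ + p′ → p ≤ p′
count-rows≤columns {n} {A} (k , k>0 , w) S T vanish {p} {p′} ∑S ∑T =
  ℤ.drop‿+≤+ (ℤ.*-cancelʳ-≤-pos (+ p) (+ p′) k {{k>0}} p*k≤p′*k)
  where
  -- Membership of the row may be traded for membership of the column, because the square vanishes
  -- wherever the two differ.
  agree : ∀ i j → indicator (S i) *ℤ (A i j *ℤ A i j) ≡ indicator (T j) *ℤ (A i j *ℤ A i j)
  agree i j with S i Bool.≟ T j
  ... | yes eq = cong (λ b → indicator b *ℤ _) eq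
  ... | no ne rewrite vanish i j ne = trans (ℤ.*-zeroʳ (indicator (S i))) (sym (ℤ.*-zeroʳ (indicator (T j))))

  0≤k : 0ℤ ≤ℤ k
  0≤k = ℤ.<⇒≤ (ℤ.positive⁻¹ k {{k>0}})

  column : ∀ b j → indicator b *ℤ ∑ n (λ i → A i j *ℤ A i j) ≤ℤ indicator b *ℤ k
  column true  j = ℤ.*-monoˡ-≤-nonNeg 1ℤ (columnNorm≤ {A = A} 0≤k w j)
  column false j = ℤ.≤-refl

  p*k≤p′*k : + p *ℤ k ≤ℤ + p′ *ℤ k
  p*k≤p′*k = ℤR.begin
    + p *ℤ k
      ℤR.≡⟨ cong (_*ℤ k) (sym ∑S) ⟩
    ∑ n (λ i → indicator (S i)) *ℤ k
      ℤR.≡⟨ sym (∑-*ʳ n _ k) ⟩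
    ∑ n (λ i → indicator (S i) *ℤ k)
      ℤR.≡⟨ ∑-cong n (λ i → trans (cong (indicator (S i) *ℤ_) (sym (rowNorm {A = A} w i))) (sym (∑-*ˡ n (indicator (S i)) _))) ⟩
    ∑ n (λ i → ∑ n (λ j → indicator (S i) *ℤ (A i j *ℤ A i j)))
      ℤR.≡⟨ ∑-cong n (λ i → ∑-cong n (agree i)) ⟩
    ∑ n (λ i → ∑ n (λ j → indicator (T j) *ℤ (A i j *ℤ A i j)))
      ℤR.≡⟨ ∑-swap n n _ ⟩
    ∑ n (λ j → ∑ n (λ i → indicator (T j) *ℤ (A i j *ℤ A i j)))
      ℤR.≡⟨ ∑-cong n (λ j → ∑-*ˡ n (indicator (T j)) _) ⟩
    ∑ n (λ j → indicator (T j) *ℤ ∑ n (λ i → A i j *ℤ A i j))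
      ℤR.≤⟨ ∑-mono-≤ n (λ j → column (T j) j) ⟩
    ∑ n (λ j → indicator (T j) *ℤ k)
      ℤR.≡⟨ ∑-*ʳ n _ k ⟩
    ∑ n (λ j → indicator (T j)) *ℤ k
      ℤR.≡⟨ cong (_*ℤ k) ∑T ⟩
    + p′ *ℤ k ℤR.∎
    where module ℤR = ℤ.≤-Reasoning

-- Listing `S` before its complement among the rows, and `T` before its complement among the
-- columns, turns the two mixed rectangles into the zero corners of `B ⊕ C`. Both partitions must
-- have the same sizes for the remaining corners to be square.
⊕-∼H : ∀ {n p q} {A : SqMat n} {S T : Fin n → Bool} → Partition S p q → Partition T p q →
       (∀ i j → S i ≢ T j → A i j ≡ 0ℤ) → (e : p + q ≡ n) →
       Σ (SqMat p) λ B → Σ (SqMat q) λ C → A ∼H subst SqMat e (B ⊕ C)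
⊕-∼H {p = p} {q} {A} {S} {T} PS PT vanish refl = B , C , Carries⇒∼H {x = unshuffle PS} {unshuffle PT} (mkCarries entries)
  where
  module PS = Partition PS
  module PT = Partition PT
  B : SqMat p
  B a b = A (PS.element (inj₁ a)) (PT.element (inj₁ b))
  C : SqMat q
  C a b = A (PS.element (inj₂ a)) (PT.element (inj₂ b))
  unshuffle : ∀ {U} → Partition U p q → SignedBij (Fin (p + q)) (Fin (p + q))
  unshuffle P = unsigned (element ∘ splitAt p) (join p q ∘ classify)
    (λ i → trans (cong (join p q) (classify-element (splitAt p i))) (join-splitAt p q i))
    (λ j → trans (cong element (splitAt-join p q (classify j))) (element-classify j))
    where open Partition P
  entries : ∀ i j → A (PS.element (splitAt p i)) (PT.element (splitAt p j)) ≡ (B ⊕ C) i j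
  entries i j with splitAt p i | splitAt p j
  ... | inj₁ a | inj₁ b = refl
  ... | inj₂ a | inj₂ b = refl
  ... | inj₁ a | inj₂ b = vanish _ _ λ eq →
    case trans (sym (PS.inside a)) (trans eq (PT.outside b)) of λ ()
  ... | inj₂ a | inj₁ b = vanish _ _ λ eq →
    case trans (sym (PT.inside b)) (trans (sym eq) (PS.outside a)) of λ ()

-- The hypothesis on zeros is symmetric under complementing both sets, so counting gives `p ≤ p′`
-- and `q ≤ q′`. As `p + q` and `p′ + q′` both equal `n`, these are equalities. If `p` and `q` were
-- both positive, `A` would decompose; `i₀` rules out `p = 0`, which leaves `q = 0`.
primitive-connected : ∀ {n} {A : SqMat n} → IsPosWeighing A → IsPrimitive A → (S T : Fin n → Bool) →
                      (∀ i j → S i ≢ T j → A i j ≡ 0ℤ) → ∀ i₀ → S i₀ ≡ true →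
                      (∀ i → S i ≡ true) × (∀ j → T j ≡ true)
primitive-connected {n} {A} w prim S T vanish i₀ Si₀
  with partition S | partition T
... | p , q , PS | p′ , q′ , PT with p≡p′ | q≡q′
  where
  module PS = Partition PS
  module PT = Partition PT
  p≤p′ : p ≤ p′
  p≤p′ = count-rows≤columns w S T vanish PS.∑-inside PT.∑-inside
  q≤q′ : q ≤ q′
  q≤q′ = count-rows≤columns w (not ∘ S) (not ∘ T) (λ i j ne → vanish i j (ne ∘ cong not))
           PS.∑-outside PT.∑-outside
  sizes : p + q ≡ p′ + q′
  sizes = trans PS.size (sym PT.size)
  p≡p′ : p ≡ p′
  p≡p′ = ℕ.≤-antisym p≤p′ (ℕ.+-cancelʳ-≤ q p′ p
    (ℕ.≤-trans (ℕ.+-monoʳ-≤ p′ q≤q′) (ℕ.≤-reflexive (sym sizes))))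
  q≡q′ : q ≡ q′
  q≡q′ = ℕ.+-cancelˡ-≡ p q q′ (trans sizes (cong (_+ q′) (sym p≡p′)))
primitive-connected {n} {A} w prim S T vanish i₀ Si₀
  | p , zero , PS | .p , .zero , PT | refl | refl = everywhere PS , everywhere PT
  where
  everywhere : ∀ {U p} → Partition U p 0 → ∀ i → U i ≡ true
  everywhere P i with Partition.classify P i | Partition.element-classify P i
  ... | inj₁ a | eq = trans (cong _ (sym eq)) (Partition.inside P a)
primitive-connected {n} {A} w prim S T vanish i₀ Si₀
  | zero , suc q , PS | .zero , .(suc q) , PT | refl | refl
  with Partition.classify PS i₀ | Partition.element-classify PS i₀
... | inj₂ b | refl with trans (sym Si₀) (Partition.outside PS b)
... | ()
primitive-connected {n} {A} w prim S T vanish i₀ Si₀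
  | suc p , suc q , PS | .(suc p) , .(suc q) , PT | refl | refl =
  let B , C , A∼B⊕C = ⊕-∼H {A = A} PS PT vanish (Partition.size PS)
  in ⊥-elim (prim (suc p , suc q , Partition.size PS , B , C , s≤s z≤n , s≤s z≤n , A∼B⊕C))

-- Automorphisms as pairs of signed bijections

record SAut {I J : Set} (M : I → J → ℤ) : Set where
  field
    rows    : SignedBij I I
    columns : SignedBij J J
    carries : Carries rows columns M M

open SAut

infix 4 _≈A_

record _≈A_ {I J : Set} {M : I → J → ℤ} (g h : SAut M) : Set where
  constructor mk≈A
  field
    rows-≈    : rows g ≈S rows h
    columns-≈ : columns g ≈S columns h

open _≈A_

≈A-sym : ∀ {I J} {M : I → J → ℤ} {g h : SAut M} → g ≈A h → h ≈A g
≈A-sym (mk≈A p q) = mk≈A (≈S-sym p) (≈S-sym q)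

≈A-trans : ∀ {I J} {M : I → J → ℤ} {g h k : SAut M} → g ≈A h → h ≈A k → g ≈A k
≈A-trans (mk≈A p q) (mk≈A p′ q′) = mk≈A (≈S-trans p p′) (≈S-trans q q′)

_⨾A_ : ∀ {I J} {M : I → J → ℤ} → SAut M → SAut M → SAut M
g ⨾A h = record
  { rows = rows g ⨾ rows h ; columns = columns g ⨾ columns h
  ; carries = Carries-⨾ (carries g) (carries h) }

invA : ∀ {I J} {M : I → J → ℤ} → SAut M → SAut M
invA g = record
  { rows = inv (rows g) ; columns = inv (columns g) ; carries = Carries-inv (carries g) }

MulA : ∀ {I J} {M : I → J → ℤ} → SAut M → SAut M → SAut M → Set
MulA g h k = k ≈A (g ⨾A h)

-- Isomorphisms of groups given by relations, and the passage from matrices to signed bijections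

mutuallyInverse⇒iso :
  {G H : Set} {_≈G_ : G → G → Set} {_≈H_ : H → H → Set}
  {MulG : G → G → G → Set} {MulH : H → H → H → Set} →
  (∀ {x y} → x ≈G y → y ≈G x) → (∀ {x y z} → x ≈G y → y ≈G z → x ≈G z) →
  (φ : G → H) (ψ : H → G) →
  (∀ {x y} → x ≈G y → φ x ≈H φ y) → (∀ {x y} → x ≈H y → ψ x ≈G ψ y) →
  (∀ x → ψ (φ x) ≈G x) → (∀ y → φ (ψ y) ≈H y) →
  (∀ x y z → MulG x y z → MulH (φ x) (φ y) (φ z)) →
  IsGroupIso _≈G_ _≈H_ MulG MulH φ
mutuallyInverse⇒iso sym-G trans-G φ ψ φ-cong ψ-cong ψφ φψ φ-hom = record
  { cong-φ      = λ _ _ → φ-cong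
  ; injective   = λ x y eq → trans-G (sym-G (ψφ x)) (trans-G (ψ-cong eq) (ψφ y))
  ; surjective  = λ h → ψ h , φψ h
  ; homomorphic = φ-hom
  }

iso-∘ : {G H K : Set} {_≈G_ : G → G → Set} {_≈H_ : H → H → Set} {_≈K_ : K → K → Set}
        {MulG : G → G → G → Set} {MulH : H → H → H → Set} {MulK : K → K → K → Set}
        {φ : G → H} {χ : H → K} →
        (∀ {x y z} → x ≈K y → y ≈K z → x ≈K z) →
        IsGroupIso _≈G_ _≈H_ MulG MulH φ → IsGroupIso _≈H_ _≈K_ MulH MulK χ →
        IsGroupIso _≈G_ _≈K_ MulG MulK (χ ∘ φ)
iso-∘ trans-K f g = record
  { cong-φ      = λ x y → g.cong-φ _ _ ∘ f.cong-φ x y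
  ; injective   = λ x y → f.injective x y ∘ g.injective _ _
  ; surjective  = λ k → let h , χh≈k = g.surjective k
                            x , φx≈h = f.surjective h
                        in x , trans-K (g.cong-φ _ _ φx≈h) χh≈k
  ; homomorphic = λ x y z → g.homomorphic _ _ _ ∘ f.homomorphic x y z
  }
  where
  module f = IsGroupIso f
  module g = IsGroupIso g

signed : ∀ {n} {A : SqMat n} → Aut A → SAut A
signed {A = A} ((L , R) , mL , mR , eq) = record
  { rows    = proj₁ (monomial⇒signedBij mL)
  ; columns = proj₁ (monomial⇒signedBij mR)
  ; carries = mkCarries λ i j → trans
      (sym (entry-LARᵀ (proj₂ (monomial⇒signedBij mL)) (proj₂ (monomial⇒signedBij mR)) A i j)) (eq i j) }

matrices : ∀ {n} {A : SqMat n} → SAut A → Aut A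
matrices {A = A} g =
  (monomialMatrix (rows g) , monomialMatrix (columns g)) ,
  represents⇒monomial rep₁ , represents⇒monomial rep₂ ,
  λ i j → trans (entry-LARᵀ rep₁ rep₂ A i j) (entry (carries g) i j)
  where
  rep₁ = monomialMatrix-represents (rows g)
  rep₂ = monomialMatrix-represents (columns g)

record RepresentsA {n} {A : SqMat n} (g : SAut A) (a : Aut A) : Set where
  constructor mkRepresentsA
  field
    rep-rows    : Represents (rows g) (proj₁ (proj₁ a))
    rep-columns : Represents (columns g) (proj₂ (proj₁ a))

signed-represents : ∀ {n} {A : SqMat n} (a : Aut A) → RepresentsA (signed a) a
signed-represents (_ , mL , mR , _) =
  mkRepresentsA (proj₂ (monomial⇒signedBij mL)) (proj₂ (monomial⇒signedBij mR))

matrices-represents : ∀ {n} {A : SqMat n} (g : SAut A) → RepresentsA g (matrices g)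
matrices-represents g =
  mkRepresentsA (monomialMatrix-represents (rows g)) (monomialMatrix-represents (columns g))

RepresentsA-resp : ∀ {n} {A : SqMat n} {g h : SAut A} {a b : Aut A} →
                   RepresentsA g a → RepresentsA h b → g ≈A h → a ≈Aut b
RepresentsA-resp (mkRepresentsA r c) (mkRepresentsA r′ c′) (mk≈A p q) =
  Represents-resp r r′ p , Represents-resp c c′ q

RepresentsA-unique : ∀ {n} {A : SqMat n} {g h : SAut A} {a b : Aut A} →
                     RepresentsA g a → RepresentsA h b → a ≈Aut b → g ≈A h
RepresentsA-unique (mkRepresentsA r c) (mkRepresentsA r′ c′) (p , q) =
  mk≈A (Represents-unique r r′ p) (Represents-unique c c′ q)

≈Aut-refl : ∀ {n} {A : SqMat n} (a : Aut A) → a ≈Aut a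
≈Aut-refl _ = (λ _ _ → refl) , (λ _ _ → refl)

≈Aut-sym : ∀ {n} {A : SqMat n} (a b : Aut A) → a ≈Aut b → b ≈Aut a
≈Aut-sym _ _ (p , q) = (λ i j → sym (p i j)) , (λ i j → sym (q i j))

≈Aut-trans : ∀ {n} {A : SqMat n} (a b c : Aut A) → a ≈Aut b → b ≈Aut c → a ≈Aut c
≈Aut-trans _ _ _ (p , q) (p′ , q′) =
  (λ i j → trans (p i j) (p′ i j)) , (λ i j → trans (q i j) (q′ i j))

signed-iso : ∀ {n} {A : SqMat n} → IsGroupIso (_≈Aut_ {A = A}) _≈A_ MulAut MulA signed
signed-iso = mutuallyInverse⇒iso
  (λ {a} {b} → ≈Aut-sym a b) (λ {a} {b} {c} → ≈Aut-trans a b c) signed matrices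
  (λ {a} {b} → RepresentsA-unique {a = a} {b} (signed-represents a) (signed-represents b))
  (λ {g} {h} → RepresentsA-resp (matrices-represents g) (matrices-represents h))
  (λ a → RepresentsA-resp (matrices-represents (signed a)) (signed-represents a)
           (mk≈A ≈S-refl ≈S-refl))
  (λ g → RepresentsA-unique (signed-represents (matrices g)) (matrices-represents g)
           (≈Aut-refl (matrices g)))
  λ a b c (p , q) →
    let mkRepresentsA ra ca = signed-represents a
        mkRepresentsA rb cb = signed-represents b
        mkRepresentsA rc cc = signed-represents c
    in mk≈A (Represents-unique rc (Represents-⨾ ra rb) p) (Represents-unique cc (Represents-⨾ ca cb) q)

matrices-MulA : ∀ {n} {A : SqMat n} (g h k : SAut A) → MulA g h k →
                MulAut (matrices g) (matrices h) (matrices k)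
matrices-MulA g h k (mk≈A p q) =
  Represents-resp rk (Represents-⨾ rg rh) p , Represents-resp ck (Represents-⨾ cg ch) q
  where
  open RepresentsA (matrices-represents g) renaming (rep-rows to rg; rep-columns to cg)
  open RepresentsA (matrices-represents h) renaming (rep-rows to rh; rep-columns to ch)
  open RepresentsA (matrices-represents k) renaming (rep-rows to rk; rep-columns to ck)

conjA : ∀ {I J I′ J′ : Set} {M : I → J → ℤ} {N : I′ → J′ → ℤ}
        {p : SignedBij I I′} {q : SignedBij J J′} → Carries p q M N → SAut N → SAut M
conjA {p = p} {q} c g = record
  { rows = conj p (rows g) ; columns = conj q (columns g)
  ; carries = Carries-⨾ (Carries-⨾ c (carries g)) (Carries-inv c) }

conjA-iso : ∀ {I J I′ J′ : Set} {M : I → J → ℤ} {N : I′ → J′ → ℤ}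
            {p : SignedBij I I′} {q : SignedBij J J′} (c : Carries p q M N) →
            IsGroupIso _≈A_ _≈A_ MulA MulA (conjA c)
conjA-iso {p = p} {q} c = mutuallyInverse⇒iso ≈A-sym ≈A-trans (conjA c) (conjA (Carries-inv c))
  (conjA-cong c) (conjA-cong (Carries-inv c))
  (λ g → mk≈A (conj-inverseʳ p (rows g)) (conj-inverseʳ q (columns g)))
  (λ g → mk≈A (conj-inverseˡ p (rows g)) (conj-inverseˡ q (columns g)))
  λ g h k k≈gh → ≈A-trans (conjA-cong c k≈gh)
    (mk≈A (conj-⨾ p (rows g) (rows h)) (conj-⨾ q (columns g) (columns h)))
  where
  conjA-cong : ∀ {I J I′ J′ : Set} {M : I → J → ℤ} {N : I′ → J′ → ℤ}
               {p : SignedBij I I′} {q : SignedBij J J′} (c : Carries p q M N) {g h : SAut N} →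
               g ≈A h → conjA c g ≈A conjA c h
  conjA-cong {p = p} {q} c (mk≈A r s) = mk≈A (conj-cong p r) (conj-cong q s)

-- Automorphisms of a block diagonal matrix

Carries⇒HEquivHet : ∀ {m n} {A : SqMat m} {B : SqMat n} {x y : SignedBij (Fin n) (Fin m)} →
                    Carries x y B A → HEquivHet A B
Carries⇒HEquivHet {x = x} c = e , transport e c
  where
  e = ↔⇒≡ (permutation (from x) (to x) (from-to x) (to-from x))
  -- The equality of sizes found above is not `refl` by computation; stating the claim for an
  -- arbitrary `e` allows matching on it.
  transport : ∀ {m n} {A : SqMat m} {B : SqMat n} {x y : SignedBij (Fin n) (Fin m)} →
              (e : m ≡ n) → Carries x y B A → subst SqMat e A ∼H B
  transport refl = Carries⇒∼H

-- A type, a copy of that type and a position in the copy. The first two are grouped because a block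
-- is the unit that automorphisms move.
BlockIndex : ∀ {s} (n r : Fin s → ℕ) → Set
BlockIndex {s} n r = Σ (Σ (Fin s) (Fin ∘ r)) (Fin ∘ n ∘ proj₁)

module BlockDiagonal
  (s : ℕ) (n r : Fin s → ℕ) (As : (t : Fin s) → SqMat (n t))
  (nonempty : ∀ t → Fin (n t))
  -- Positivity is asked of a type only in the presence of a copy, since it is inherited from the
  -- whole matrix.
  (weighing : ∀ t → Fin (r t) → IsPosWeighing (As t))
  (primitive-As : ∀ t → IsPrimitive (As t))
  (inequivalent : ∀ t u → t ≢ u → ¬ HEquivHet (As t) (As u))
  where

  Block : Set
  Block = Σ (Fin s) (Fin ∘ r)

  Index : Set
  Index = BlockIndex n r

  _≟B_ : DecidableEquality Block
  _≟B_ = ≡-dec _≟_ _≟_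

  position-injective : ∀ {k : Block} {a b : Fin (n (proj₁ k))} → _≡_ {A = Index} (k , a) (k , b) → a ≡ b
  position-injective refl = refl

  copy-injective : ∀ {t} {i j : Fin (r t)} → _≡_ {A = Block} (t , i) (t , j) → i ≡ j
  copy-injective refl = refl

  module _ (D : Index → Index → ℤ)
           (on-block  : ∀ k a b → D (k , a) (k , b) ≡ As (proj₁ k) a b)
           (off-block : ∀ {k l} a b → k ≢ l → D (k , a) (l , b) ≡ 0ℤ)
           where

    -- Rows and columns of `k` must land in the same block. That block may still be of another type,
    -- so the positions live in sets of possibly different size.
    record BlockMap (g : SAut D) (k l : Block) : Set where
      field
        row      : Fin (n (proj₁ k)) → Fin (n (proj₁ l))
        column   : Fin (n (proj₁ k)) → Fin (n (proj₁ l))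
        row-≡    : ∀ a → to (rows g) (k , a) ≡ (l , row a)
        column-≡ : ∀ b → to (columns g) (k , b) ≡ (l , column b)

    open BlockMap

    -- The rows of block k sent into a given block l and the columns of block k
    -- sent into l meet the other columns and rows of block k in zeros only,
    -- so primitivity makes them everything as soon as one row is sent into l.
    abstract
      image : ∀ g k → Σ Block (BlockMap g k)
      image g k@(t , i) = l , record
        { row      = λ a → proj₁ (row-in a)
        ; column   = λ b → proj₁ (column-in b)
        ; row-≡    = λ a → proj₂ (row-in a)
        ; column-≡ = λ b → proj₂ (column-in b)
        }
        where
        x y : SignedBij Index Index
        x = rows g
        y = columns g
        l : Block
        l = proj₁ (to x (k , nonempty t))
        S T : Fin (n t) → Bool
        S a = does (proj₁ (to x (k , a)) ≟B l)
        T b = does (proj₁ (to y (k , b)) ≟B l)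
        vanish : ∀ a b → S a ≢ T b → As t a b ≡ 0ℤ
        vanish a b Sa≢Tb = begin
          As t a b
            ≡⟨ sym (on-block k a b) ⟩
          D (k , a) (k , b)
            ≡⟨ sym (entry (carries g) (k , a) (k , b)) ⟩
          (sgn x (k , a) *ₛ sgn y (k , b)) • D (to x (k , a)) (to y (k , b))
            ≡⟨ cong ((sgn x (k , a) *ₛ sgn y (k , b)) •_)
                    (off-block _ _ (Sa≢Tb ∘ cong (λ m → does (m ≟B l)))) ⟩
          (sgn x (k , a) *ₛ sgn y (k , b)) • 0ℤ
            ≡⟨ •-zero (sgn x (k , a) *ₛ sgn y (k , b)) ⟩
          0ℤ ∎
        connected : (∀ a → S a ≡ true) × (∀ b → T b ≡ true)
        connected = primitive-connected (weighing t i) (primitive-As t) S T vanish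
                      (nonempty t) (dec-true (l ≟B l) refl)
        locate : (z : Index) → does (proj₁ z ≟B l) ≡ true → Σ (Fin (n (proj₁ l))) λ a → z ≡ (l , a)
        locate (m , a) eq with m ≟B l
        ... | yes refl = a , refl
        locate (m , a) () | no _
        row-in : ∀ a → Σ (Fin (n (proj₁ l))) λ a′ → to x (k , a) ≡ (l , a′)
        row-in a = locate (to x (k , a)) (proj₁ connected a)
        column-in : ∀ b → Σ (Fin (n (proj₁ l))) λ b′ → to y (k , b) ≡ (l , b′)
        column-in b = locate (to y (k , b)) (proj₂ connected b)

    -- The image of a single row determines the target block, and every block has a row. Later
    -- equations between chosen images all rest on this and never on how `image` chooses.
    blockMap-unique : ∀ {g h k l l′} → BlockMap g k l → BlockMap h k l′ →
                      (∀ z → to (rows g) z ≡ to (rows h) z) → l ≡ l′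
    blockMap-unique {k = k} m m′ g≗h = cong proj₁ (begin
      (_ , row m (nonempty (proj₁ k)))   ≡⟨ sym (row-≡ m _) ⟩
      _                                  ≡⟨ g≗h _ ⟩
      _                                  ≡⟨ row-≡ m′ _ ⟩
      (_ , row m′ (nonempty (proj₁ k)))  ∎)

    -- Surjectivity onto `l` comes from applying `image` to the inverse: `l` returns into one block,
    -- and some row of it returns to `k`.
    blockMap-inv : ∀ {g k l} → BlockMap g k l → BlockMap (invA g) l k
    blockMap-inv {g} {k} {l} m with image (invA g) l
    ... | k′ , m′ with k′≡k
      where
      k′≡k : k′ ≡ k
      k′≡k = cong proj₁ (begin
        (k′ , row m′ (row m a))                  ≡⟨ sym (row-≡ m′ _) ⟩
        from (rows g) (l , row m a)              ≡⟨ cong (from (rows g)) (sym (row-≡ m a)) ⟩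
        from (rows g) (to (rows g) (k , a))      ≡⟨ from-to (rows g) _ ⟩
        (k , a)                                  ∎)
        where a = nonempty (proj₁ k)
    ... | refl = m′

    blockMap-⨾ : ∀ {g h k l l′} → BlockMap g k l → BlockMap h l l′ → BlockMap (g ⨾A h) k l′
    blockMap-⨾ {g} {h} m m′ = record
      { row      = row m′ ∘ row m
      ; column   = column m′ ∘ column m
      ; row-≡    = λ a → trans (cong (to (rows h)) (row-≡ m a)) (row-≡ m′ _)
      ; column-≡ = λ b → trans (cong (to (columns h)) (column-≡ m b)) (column-≡ m′ _)
      }

    restrictBij : ∀ {k l} (x : SignedBij Index Index)
                  (f : Fin (n (proj₁ k)) → Fin (n (proj₁ l))) (f⁻¹ : Fin (n (proj₁ l)) → Fin (n (proj₁ k))) →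
                  (∀ a → to x (k , a) ≡ (l , f a)) → (∀ a → from x (l , a) ≡ (k , f⁻¹ a)) →
                  SignedBij (Fin (n (proj₁ k))) (Fin (n (proj₁ l)))
    restrictBij {k} {l} x f f⁻¹ f-≡ f⁻¹-≡ = record
      { to      = f
      ; from    = f⁻¹
      ; sgn     = λ a → sgn x (k , a)
      ; from-to = λ a → position-injective (begin
          (k , f⁻¹ (f a))          ≡⟨ sym (f⁻¹-≡ _) ⟩
          from x (l , f a)         ≡⟨ cong (from x) (sym (f-≡ a)) ⟩
          from x (to x (k , a))    ≡⟨ from-to x _ ⟩
          (k , a)                  ∎)
      ; to-from = λ a → position-injective (begin
          (l , f (f⁻¹ a))          ≡⟨ sym (f-≡ _) ⟩
          to x (k , f⁻¹ a)         ≡⟨ cong (to x) (sym (f⁻¹-≡ a)) ⟩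
          to x (from x (l , a))    ≡⟨ to-from x _ ⟩
          (l , a)                  ∎)
      }

    restrictRows restrictColumns : ∀ {g k l} → BlockMap g k l →
                                   SignedBij (Fin (n (proj₁ k))) (Fin (n (proj₁ l)))
    restrictRows {g} m = restrictBij (rows g) (row m) (row m⁻¹) (row-≡ m) (row-≡ m⁻¹)
      where m⁻¹ = blockMap-inv m
    restrictColumns {g} m =
      restrictBij (columns g) (column m) (column m⁻¹) (column-≡ m) (column-≡ m⁻¹)
      where m⁻¹ = blockMap-inv m

    restrict-carries : ∀ {g k l} (m : BlockMap g k l) →
                       Carries (restrictRows m) (restrictColumns m) (As (proj₁ k)) (As (proj₁ l))
    restrict-carries {g} {k} {l} m = mkCarries λ a b →
      let ε = sgn (rows g) (k , a) *ₛ sgn (columns g) (k , b) in begin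
      ε • As (proj₁ l) (row m a) (column m b)
        ≡⟨ cong (ε •_) (sym (on-block l _ _)) ⟩
      ε • D (l , row m a) (l , column m b)
        ≡⟨ cong (ε •_) (cong₂ D (sym (row-≡ m a)) (sym (column-≡ m b))) ⟩
      ε • D (to (rows g) (k , a)) (to (columns g) (k , b))
        ≡⟨ entry (carries g) _ _ ⟩
      D (k , a) (k , b)
        ≡⟨ on-block k a b ⟩
      As (proj₁ k) a b ∎

    component : ∀ {g t i j} → BlockMap g (t , i) (t , j) → SAut (As t)
    component m = record
      { rows = restrictRows m ; columns = restrictColumns m ; carries = restrict-carries m }

    component-cong : ∀ {g h t i j j′} (m : BlockMap g (t , i) (t , j)) (m′ : BlockMap h (t , i) (t , j′)) →
                     g ≈A h → component m ≈A component m′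
    component-cong {g} {h} m m′ g≈h with blockMap-unique m m′ (to-≡ (rows-≈ g≈h))
    ... | refl = mk≈A
      (mk≈ (λ a → position-injective (trans (sym (row-≡ m a)) (trans (to-≡ (rows-≈ g≈h) _) (row-≡ m′ a))))
           (λ a → sgn-≡ (rows-≈ g≈h) _))
      (mk≈ (λ b → position-injective (trans (sym (column-≡ m b)) (trans (to-≡ (columns-≈ g≈h) _) (column-≡ m′ b))))
           (λ b → sgn-≡ (columns-≈ g≈h) _))

    component-⨾ : ∀ {g h t i j l} (m : BlockMap g (t , i) (t , j)) (m′ : BlockMap h (t , j) (t , l)) →
                  component (blockMap-⨾ m m′) ≈A (component m ⨾A component m′)
    component-⨾ {g} {h} m m′ = mk≈A
      (mk≈ (λ _ → refl) (λ a → cong (λ z → sgn (rows g) _ *ₛ sgn (rows h) z) (row-≡ m a)))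
      (mk≈ (λ _ → refl) (λ b → cong (λ z → sgn (columns g) _ *ₛ sgn (columns h) z) (column-≡ m b)))

    -- The restriction writes the source type as a monomial transform of the target type, so the
    -- H-equivalence obtained runs from target to source.
    sameType : ∀ {g k l} → BlockMap g k l → proj₁ k ≡ proj₁ l
    sameType {k = t , _} {u , _} m with u ≟ t
    ... | yes u≡t = sym u≡t
    ... | no u≢t = ⊥-elim (inequivalent u t u≢t (Carries⇒HEquivHet (restrict-carries m)))

    abstract
      copyImage : ∀ g t i → Σ (Fin (r t)) λ j → BlockMap g (t , i) (t , j)
      copyImage g t i with image g (t , i)
      ... | (u , j) , m with sameType m
      ... | refl = j , m

    copyMap : SAut D → ∀ t → Fin (r t) → Fin (r t)
    copyMap g t i = proj₁ (copyImage g t i)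

    copyMap-unique : ∀ {g t i j} → BlockMap g (t , i) (t , j) → copyMap g t i ≡ j
    copyMap-unique {g} {t} {i} m =
      copy-injective (blockMap-unique (proj₂ (copyImage g t i)) m (λ _ → refl))

    -- A monomial matrix whose row i has its nonzero entry in column σ i acts on
    -- column vectors through σ⁻¹, so it is the inverse of g that moves the copies.
    copyPermutation : SAut D → ∀ t → Permutation′ (r t)
    copyPermutation g t = permutation (copyMap (invA g) t) (copyMap g t)
      (λ i → copyMap-unique (blockMap-inv (proj₂ (copyImage g t i))))
      (λ i → copyMap-unique (reinvert (blockMap-inv (proj₂ (copyImage (invA g) t i)))))
      where
      -- A `BlockMap` involves only `to`, which double inversion restores by computation; the signs
      -- are restored only up to a proof.
      reinvert : ∀ {k l} → BlockMap (invA (invA g)) k l → BlockMap g k l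
      reinvert m = record { row = row m ; column = column m ; row-≡ = row-≡ m ; column-≡ = column-≡ m }

    -- Indexing the factors by the source copy fits the wreath multiplication `h(i) h′(σ⁻¹ i)`: the
    -- first automorphism takes copy `i` to `σ⁻¹ i`, and there the factor of the second one acts.
    localAut : SAut D → ∀ t → Fin (r t) → SAut (As t)
    localAut g t i = component (proj₂ (copyImage g t i))

    toWreath : SAut D → WreathProd s n r As
    toWreath g t = (λ i → matrices (localAut g t i)) , copyPermutation g t

    toWreath-cong : ∀ g h → g ≈A h → _≈W_ {A = As} (toWreath g) (toWreath h)
    toWreath-cong g h g≈h t =
      (λ i → RepresentsA-resp (matrices-represents (localAut g t i)) (matrices-represents (localAut h t i))
               (component-cong (proj₂ (copyImage g t i)) (proj₂ (copyImage h t i)) g≈h)) ,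
      (λ i → copy-injective (blockMap-unique (proj₂ (copyImage (invA g) t i))
               (proj₂ (copyImage (invA h) t i)) (from-cong (rows-≈ g≈h))))

    toWreath-injective : ∀ g h → _≈W_ {A = As} (toWreath g) (toWreath h) → g ≈A h
    toWreath-injective g h eq = mk≈A
      (mk≈ (λ { ((t , i) , a) → trans (row-≡ (m g t i) a)
                  (trans (cong₂ (λ j b → (t , j) , b) (copies t i) (to-≡ (rows-≈ (parts t i)) a))
                         (sym (row-≡ (m h t i) a))) })
           (λ { ((t , i) , a) → sgn-≡ (rows-≈ (parts t i)) a }))
      (mk≈ (λ { ((t , i) , b) → trans (column-≡ (m g t i) b)
                  (trans (cong₂ (λ j b → (t , j) , b) (copies t i) (to-≡ (columns-≈ (parts t i)) b))
                         (sym (column-≡ (m h t i) b))) })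
           (λ { ((t , i) , b) → sgn-≡ (columns-≈ (parts t i)) b }))
      where
      m = λ g t i → proj₂ (copyImage g t i)
      parts : ∀ t i → localAut g t i ≈A localAut h t i
      parts t i = RepresentsA-unique (matrices-represents (localAut g t i)) (matrices-represents (localAut h t i)) (proj₁ (eq t) i)
      -- Permutations are compared in the forward direction, while `copyMap` is the backward one.
      copies : ∀ t i → copyMap g t i ≡ copyMap h t i
      copies t i = begin
        π ⟨$⟩ˡ i                    ≡⟨ cong (π ⟨$⟩ˡ_) (sym (inverseʳ ρ)) ⟩
        π ⟨$⟩ˡ (ρ ⟨$⟩ʳ (ρ ⟨$⟩ˡ i))  ≡⟨ cong (π ⟨$⟩ˡ_) (sym (proj₂ (eq t) _)) ⟩
        π ⟨$⟩ˡ (π ⟨$⟩ʳ (ρ ⟨$⟩ˡ i))  ≡⟨ inverseˡ π ⟩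
        ρ ⟨$⟩ˡ i                    ∎
        where
        π = copyPermutation g t
        ρ = copyPermutation h t

    toWreath-homomorphic : ∀ g h k → MulA g h k → MulW {A = As} (toWreath g) (toWreath h) (toWreath k)
    toWreath-homomorphic g h k k≈gh t =
      (λ i → let m = proj₂ (copyImage g t i) ; m′ = proj₂ (copyImage h t (copyMap g t i)) in
             matrices-MulA (localAut g t i) (localAut h t (copyMap g t i)) (localAut k t i)
               (≈A-trans (component-cong (proj₂ (copyImage k t i)) (blockMap-⨾ m m′) k≈gh)
                                     (component-⨾ m m′))) ,
      -- The inverse of a product reverses its factors, so `h` inverse comes first; as functions
      -- this is the composition `σ ∘ σ′`.
      (λ i → let m = proj₂ (copyImage (invA h) t i) ; m′ = proj₂ (copyImage (invA g) t (copyMap (invA h) t i)) in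
             copy-injective (blockMap-unique (proj₂ (copyImage (invA k) t i)) (blockMap-⨾ m m′)
                                             (from-cong (rows-≈ k≈gh))))

    module FromWreath (w : WreathProd s n r As) where

      π : ∀ t → Permutation′ (r t)
      π t = proj₂ (w t)

      part : ∀ t → Fin (r t) → SAut (As t)
      part t i = signed (proj₁ (w t) i)

      -- Copy `i` travels to `π⁻¹ i` by its own factor, so the way back from copy `j` must use the
      -- factor of its source `π j`.
      assemble : (∀ t → Fin (r t) → SignedBij (Fin (n t)) (Fin (n t))) → SignedBij Index Index
      assemble x = record
        { to      = λ { ((t , i) , a) → (t , π t ⟨$⟩ˡ i) , to (x t i) a }
        ; from    = λ { ((t , j) , a) → (t , π t ⟨$⟩ʳ j) , from (x t (π t ⟨$⟩ʳ j)) a }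
        ; sgn     = λ { ((t , i) , a) → sgn (x t i) a }
        ; from-to = λ { ((t , i) , a) → from-to-at t a (inverseʳ (π t)) }
        ; to-from = λ { ((t , j) , a) → cong₂ (λ i b → (t , i) , b) (inverseˡ (π t)) (to-from (x t _) a) }
        }
        where
        -- The factor used on the way back is indexed by `π (π⁻¹ i)`, which equals `i` only by a
        -- proof; hence the free `i′`.
        from-to-at : ∀ t {i i′} a → i′ ≡ i →
                     _≡_ {A = Index} ((t , i′) , from (x t i′) (to (x t i) a)) ((t , i) , a)
        from-to-at t {i} a refl = cong ((t , i) ,_) (from-to (x t i) a)

      assembled : SAut D
      assembled = record
        { rows    = x
        ; columns = y
        ; carries = mkCarries entries
        }
        where
        x y : SignedBij Index Index
        x = assemble (λ t i → rows (part t i))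
        y = assemble (λ t i → columns (part t i))
        move : Block → Block
        move (t , i) = t , π t ⟨$⟩ˡ i
        move-injective : ∀ k l → move k ≡ move l → k ≡ l
        move-injective (t , i) (u , j) eq with cong proj₁ eq
        ... | refl = cong (t ,_) (begin
          i                        ≡⟨ sym (inverseʳ (π t)) ⟩
          π t ⟨$⟩ʳ (π t ⟨$⟩ˡ i)    ≡⟨ cong (π t ⟨$⟩ʳ_) (copy-injective eq) ⟩
          π t ⟨$⟩ʳ (π t ⟨$⟩ˡ j)    ≡⟨ inverseʳ (π t) ⟩
          j                        ∎)
        entries : ∀ z z′ → (sgn x z *ₛ sgn y z′) • D (to x z) (to y z′) ≡ D z z′
        entries (k@(t , i) , a) (l@(u , j) , b) with k ≟B l
        ... | yes refl = begin
          ε • D (move k , _) (move k , _)  ≡⟨ cong (ε •_) (on-block (move k) _ _) ⟩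
          ε • As t _ _                     ≡⟨ entry (carries (part t i)) a b ⟩
          As t a b                         ≡⟨ sym (on-block k a b) ⟩
          D (k , a) (k , b)                ∎
          where ε = sgn (rows (part t i)) a *ₛ sgn (columns (part t i)) b
        ... | no k≢l = begin
          ε • D (move k , _) (move l , _)  ≡⟨ cong (ε •_) (off-block _ _ (k≢l ∘ move-injective k l)) ⟩
          ε • 0ℤ                           ≡⟨ •-zero ε ⟩
          0ℤ                               ≡⟨ sym (off-block a b k≢l) ⟩
          D (k , a) (l , b)                ∎
          where ε = sgn (rows (part t i)) a *ₛ sgn (columns (part u j)) b

      blockMap : ∀ t i → BlockMap assembled (t , i) (t , π t ⟨$⟩ˡ i)
      blockMap t i = record
        { row = to (rows (part t i)) ; column = to (columns (part t i))
        ; row-≡ = λ _ → refl ; column-≡ = λ _ → refl }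

      blockMap⁻¹ : ∀ t i → BlockMap (invA assembled) (t , i) (t , π t ⟨$⟩ʳ i)
      blockMap⁻¹ t i = record
        { row = from (rows (part t (π t ⟨$⟩ʳ i))) ; column = from (columns (part t (π t ⟨$⟩ʳ i)))
        ; row-≡ = λ _ → refl ; column-≡ = λ _ → refl }

      toWreath-assembled : _≈W_ {A = As} (toWreath assembled) w
      toWreath-assembled t =
        (λ i → RepresentsA-resp (matrices-represents (localAut assembled t i)) (signed-represents (proj₁ (w t) i))
                 (≈A-trans (component-cong (proj₂ (copyImage assembled t i)) (blockMap t i)
                              (mk≈A ≈S-refl ≈S-refl))
                           (mk≈A (mk≈ (λ _ → refl) (λ _ → refl)) (mk≈ (λ _ → refl) (λ _ → refl))))) ,
        (λ i → copyMap-unique (blockMap⁻¹ t i))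

    abstract
      wreath-iso : Σ (SAut D → WreathProd s n r As) (IsGroupIso _≈A_ (_≈W_ {A = As}) MulA MulW)
      wreath-iso = toWreath , record
        { cong-φ      = toWreath-cong
        ; injective   = toWreath-injective
        ; surjective  = λ w → FromWreath.assembled w , FromWreath.toWreath-assembled w
        ; homomorphic = toWreath-homomorphic
        }

-- The index set of blockSum

⊕-↑ˡ↑ˡ : ∀ {m n} (X : SqMat m) (Y : SqMat n) i j → (X ⊕ Y) (i ↑ˡ n) (j ↑ˡ n) ≡ X i j
⊕-↑ˡ↑ˡ {m} {n} X Y i j rewrite splitAt-↑ˡ m i n | splitAt-↑ˡ m j n = refl

⊕-↑ʳ↑ʳ : ∀ {m n} (X : SqMat m) (Y : SqMat n) i j → (X ⊕ Y) (m ↑ʳ i) (m ↑ʳ j) ≡ Y i j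
⊕-↑ʳ↑ʳ {m} {n} X Y i j rewrite splitAt-↑ʳ m n i | splitAt-↑ʳ m n j = refl

⊕-↑ˡ↑ʳ : ∀ {m n} (X : SqMat m) (Y : SqMat n) i j → (X ⊕ Y) (i ↑ˡ n) (m ↑ʳ j) ≡ 0ℤ
⊕-↑ˡ↑ʳ {m} {n} X Y i j rewrite splitAt-↑ˡ m i n | splitAt-↑ʳ m n j = refl

⊕-↑ʳ↑ˡ : ∀ {m n} (X : SqMat m) (Y : SqMat n) i j → (X ⊕ Y) (m ↑ʳ i) (j ↑ˡ n) ≡ 0ℤ
⊕-↑ʳ↑ˡ {m} {n} X Y i j rewrite splitAt-↑ʳ m n i | splitAt-↑ˡ m j n = refl

-- `combine` unfolds along the copies exactly as `^⊕` does, so each step of the induction reads off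
-- one corner of `⊕`.
^⊕-diagonal : ∀ {m r} (X : SqMat m) (i : Fin r) a b → (X ^⊕ r) (combine i a) (combine i b) ≡ X a b
^⊕-diagonal {r = suc r} X zero    a b = ⊕-↑ˡ↑ˡ X (X ^⊕ r) a b
^⊕-diagonal {r = suc r} X (suc i) a b = trans (⊕-↑ʳ↑ʳ X (X ^⊕ r) _ _) (^⊕-diagonal X i a b)

^⊕-offDiagonal : ∀ {m r} (X : SqMat m) {i j : Fin r} a b → i ≢ j → (X ^⊕ r) (combine i a) (combine j b) ≡ 0ℤ
^⊕-offDiagonal {r = suc r} X {zero}  {zero}  a b i≢j = ⊥-elim (i≢j refl)
^⊕-offDiagonal {r = suc r} X {zero}  {suc j} a b i≢j = ⊕-↑ˡ↑ʳ X (X ^⊕ r) _ _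
^⊕-offDiagonal {r = suc r} X {suc i} {zero}  a b i≢j = ⊕-↑ʳ↑ˡ X (X ^⊕ r) _ _
^⊕-offDiagonal {r = suc r} X {suc i} {suc j} a b i≢j =
  trans (⊕-↑ʳ↑ʳ X (X ^⊕ r) _ _) (^⊕-offDiagonal X a b (i≢j ∘ cong suc))

shift : ∀ {s} {n r : Fin (suc s) → ℕ} → BlockIndex (n ∘ suc) (r ∘ suc) → BlockIndex n r
shift ((t , i) , a) = (suc t , i) , a

encode : ∀ {s} (n r : Fin s → ℕ) → BlockIndex n r → Fin (blockDim s n r)
encode {suc s} n r ((zero  , i) , a) = combine i a ↑ˡ blockDim s (n ∘ suc) (r ∘ suc)
encode {suc s} n r ((suc t , i) , a) = (r zero * n zero) ↑ʳ encode (n ∘ suc) (r ∘ suc) ((t , i) , a)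

decode : ∀ {s} (n r : Fin s → ℕ) → Fin (blockDim s n r) → BlockIndex n r
decode {suc s} n r z =
  [ (λ y → (zero , proj₁ (remQuot {r zero} (n zero) y)) , proj₂ (remQuot {r zero} (n zero) y))
  , shift ∘ decode (n ∘ suc) (r ∘ suc) ]′ (splitAt (r zero * n zero) z)

decode-encode : ∀ {s} (n r : Fin s → ℕ) z → decode n r (encode n r z) ≡ z
decode-encode {suc s} n r ((zero , i) , a)
  rewrite splitAt-↑ˡ (r zero * n zero) (combine i a) (blockDim s (n ∘ suc) (r ∘ suc))
  = cong (λ (i , a) → (zero , i) , a) (remQuot-combine i a)
decode-encode {suc s} n r ((suc t , i) , a)
  rewrite splitAt-↑ʳ (r zero * n zero) (blockDim s (n ∘ suc) (r ∘ suc))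
            (encode (n ∘ suc) (r ∘ suc) ((t , i) , a))
        | decode-encode (n ∘ suc) (r ∘ suc) ((t , i) , a) = refl

encode-decode : ∀ {s} (n r : Fin s → ℕ) z → encode n r (decode n r z) ≡ z
encode-decode {suc s} n r z
  with splitAt (r zero * n zero) z | join-splitAt (r zero * n zero) (blockDim s (n ∘ suc) (r ∘ suc)) z
... | inj₁ y | eq = trans (cong (_↑ˡ _) (combine-remQuot {r zero} (n zero) y)) eq
... | inj₂ y | eq = trans (cong ((r zero * n zero) ↑ʳ_) (encode-decode (n ∘ suc) (r ∘ suc) y)) eq

blockSum-diagonal : ∀ {s} (n r : Fin s → ℕ) (As : ∀ t → SqMat (n t)) k a b →
                    blockSum s n r As (encode n r (k , a)) (encode n r (k , b)) ≡ As (proj₁ k) a b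
blockSum-diagonal {suc s} n r As (zero  , i) a b =
  trans (⊕-↑ˡ↑ˡ (As zero ^⊕ r zero) _ _ _) (^⊕-diagonal (As zero) i a b)
blockSum-diagonal {suc s} n r As (suc t , i) a b =
  trans (⊕-↑ʳ↑ʳ (As zero ^⊕ r zero) _ _ _)
        (blockSum-diagonal (n ∘ suc) (r ∘ suc) (λ t → As (suc t)) (t , i) a b)

blockSum-offDiagonal : ∀ {s} (n r : Fin s → ℕ) (As : ∀ t → SqMat (n t)) {k l} a b → k ≢ l →
                       blockSum s n r As (encode n r (k , a)) (encode n r (l , b)) ≡ 0ℤ
blockSum-offDiagonal {suc s} n r As {zero , i} {zero , j} a b k≢l =
  trans (⊕-↑ˡ↑ˡ (As zero ^⊕ r zero) _ _ _) (^⊕-offDiagonal (As zero) a b (k≢l ∘ cong (zero ,_)))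
blockSum-offDiagonal {suc s} n r As {zero , i} {suc u , j} a b k≢l = ⊕-↑ˡ↑ʳ (As zero ^⊕ r zero) _ _ _
blockSum-offDiagonal {suc s} n r As {suc t , i} {zero , j} a b k≢l = ⊕-↑ʳ↑ˡ (As zero ^⊕ r zero) _ _ _
blockSum-offDiagonal {suc s} n r As {suc t , i} {suc u , j} a b k≢l =
  trans (⊕-↑ʳ↑ʳ (As zero ^⊕ r zero) _ _ _)
        (blockSum-offDiagonal (n ∘ suc) (r ∘ suc) (λ t → As (suc t)) a b
          (λ { refl → k≢l refl }))

-- Cardinalities

HasSize-map : {X Y : Set} (_≈X_ : X → X → Set) (_≈Y_ : Y → Y → Set) (f : X → Y) →
              (∀ {x y z} → x ≈Y y → y ≈Y z → x ≈Y z) →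
              (∀ x y → x ≈X y → f x ≈Y f y) → (∀ x y → f x ≈Y f y → x ≈X y) →
              (∀ y → Σ X λ x → f x ≈Y y) → ∀ {N} → HasSize _≈X_ N → HasSize _≈Y_ N
HasSize-map _ _ f trans-Y f-cong f-inj f-surj (e , e-inj , e-surj) =
  f ∘ e , (λ i j → e-inj i j ∘ f-inj _ _) ,
  λ y → let x , fx≈y = f-surj y
            i , ei≈x = e-surj x
        in i , trans-Y (f-cong _ _ ei≈x) fx≈y

HasSize-× : {X Y : Set} (_≈X_ : X → X → Set) (_≈Y_ : Y → Y → Set) {N M : ℕ} →
            HasSize _≈X_ N → HasSize _≈Y_ M →
            HasSize {X × Y} (λ p q → (proj₁ p ≈X proj₁ q) × (proj₂ p ≈Y proj₂ q)) (N * M)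
HasSize-× _≈X_ _≈Y_ {N} {M} (e , e-inj , e-surj) (f , f-inj , f-surj) =
  (λ i → e (proj₁ (remQuot {N} M i)) , f (proj₂ (remQuot {N} M i))) ,
  (λ i j (p , q) → begin
    i                                ≡⟨ sym (combine-remQuot {N} M i) ⟩
    uncurry combine (remQuot {N} M i)  ≡⟨ cong₂ combine (e-inj _ _ p) (f-inj _ _ q) ⟩
    uncurry combine (remQuot {N} M j)  ≡⟨ combine-remQuot {N} M j ⟩
    j                                ∎) ,
  λ (x , y) → let i , ei≈x = e-surj x
                  j , fj≈y = f-surj y
              in combine i j , 
                 subst (λ p → (e (proj₁ p) ≈X x) × (f (proj₂ p) ≈Y y)) (sym (remQuot-combine i j)) (ei≈x , fj≈y)

-- Sizes count classes of a relation, and functions are compared pointwise, so no extensionality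
-- enters. It serves both for the powers over the copies and for the product over the types.
HasSize-Π : ∀ s {X : Fin s → Set} (_≈_ : ∀ {t} → X t → X t → Set) →
            (∀ {t} {x y z : X t} → x ≈ y → y ≈ z → x ≈ z) →
            (N : Fin s → ℕ) → (∀ t → HasSize (_≈_ {t}) (N t)) →
            HasSize {∀ t → X t} (λ f g → ∀ t → f t ≈ g t) (∏ s N)
HasSize-Π zero    _   trans-X N sizes =
  (λ _ ()) , (λ { zero zero _ → refl }) , λ _ → zero , λ ()
HasSize-Π (suc s) {X} _≈_ trans-X N sizes =
  HasSize-map (λ p q → (proj₁ p ≈ proj₁ q) × (∀ t → proj₂ p t ≈ proj₂ q t)) (λ f g → ∀ t → f t ≈ g t) cons
    (λ p q t → trans-X (p t) (q t))
    (λ { _ _ (p , q) zero → p ; _ _ (p , q) (suc t) → q t })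
    (λ _ _ p → p zero , p ∘ suc)
    (λ f → let i , ei≈f0 = proj₂ (proj₂ (sizes zero)) (f zero)
               j , ej≈f′ = proj₂ (proj₂ tail) (f ∘ suc)
           in (proj₁ (sizes zero) i , proj₁ tail j) , λ { zero → ei≈f0 ; (suc t) → ej≈f′ t })
    (HasSize-× _≈_ (λ f g → ∀ t → f t ≈ g t) (sizes zero) tail)
  where
  tail = HasSize-Π s (λ {t} → _≈_ {suc t}) trans-X (N ∘ suc) (λ t → sizes (suc t))
  cons : X zero × (∀ t → X (suc t)) → ∀ t → X t
  cons (x , f) zero    = x
  cons (x , f) (suc t) = f t

∏-const : ∀ r N → ∏ r (λ _ → N) ≡ N ^ r
∏-const zero    N = refl
∏-const (suc r) N = cong (N *_) (∏-const r N)

-- A permutation of `suc r` points amounts to the image of `zero` and a permutation of the remaining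
-- points, which matches the recursion of the factorial.
Permutation-size : ∀ r → HasSize {Permutation′ r} _≈_ (r !)
Permutation-size zero    = (λ _ → idₚ) , (λ { zero zero _ → refl }) , λ _ → zero , λ ()
Permutation-size (suc r) =
  HasSize-map (λ p q → (proj₁ p ≡ proj₁ q) × (proj₂ p ≈ proj₂ q)) _≈_
    (λ (j , π) → insert zero j π) (λ p q i → trans (p i) (q i))
    insert-cong insert-injective
    (λ π → (π ⟨$⟩ʳ zero , remove zero π) , insert-remove zero π)
    (HasSize-× _≡_ _≈_ ((λ i → i) , (λ _ _ eq → eq) , (λ i → i , refl)) (Permutation-size r))
  where
  insert-cong : ∀ ((j , π) (k , ρ) : Fin (suc r) × Permutation′ r) →
                (j ≡ k) × (π ≈ ρ) → insert zero j π ≈ insert zero k ρ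
  insert-cong (j , π) (.j , ρ) (refl , π≈ρ) zero    = refl
  insert-cong (j , π) (.j , ρ) (refl , π≈ρ) (suc i) = begin
    insert zero j π ⟨$⟩ʳ suc i  ≡⟨ insert-punchIn zero j π i ⟩
    punchIn j (π ⟨$⟩ʳ i)        ≡⟨ cong (punchIn j) (π≈ρ i) ⟩
    punchIn j (ρ ⟨$⟩ʳ i)        ≡⟨ sym (insert-punchIn zero j ρ i) ⟩
    insert zero j ρ ⟨$⟩ʳ suc i  ∎
  insert-injective : ∀ ((j , π) (k , ρ) : Fin (suc r) × Permutation′ r) →
                     insert zero j π ≈ insert zero k ρ → (j ≡ k) × (π ≈ ρ)
  insert-injective (j , π) (k , ρ) eq with eq zero
  ... | refl = refl , λ i → punchIn-injective j _ _
    (trans (sym (insert-punchIn zero j π i)) (trans (eq (suc i)) (insert-punchIn zero j ρ i)))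

HasSize-iso : {G H : Set} {_≈G_ : G → G → Set} {_≈H_ : H → H → Set}
              {MulG : G → G → G → Set} {MulH : H → H → H → Set} {φ : G → H} →
              (∀ {x y} → x ≈H y → y ≈H x) → (∀ {x y z} → x ≈H y → y ≈H z → x ≈H z) →
              IsGroupIso _≈G_ _≈H_ MulG MulH φ → ∀ {N} → HasSize _≈H_ N → HasSize _≈G_ N
HasSize-iso {φ = φ} sym-H trans-H iso (e , e-inj , e-surj) =
  (λ i → proj₁ (surjective (e i))) ,
  (λ i j eq → e-inj i j (trans-H (sym-H (proj₂ (surjective (e i))))
                        (trans-H (cong-φ _ _ eq) (proj₂ (surjective (e j)))))) ,
  λ x → let i , ei≈φx = e-surj (φ x)
        in i , injective _ _ (trans-H (proj₂ (surjective (e i))) ei≈φx)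
  where open IsGroupIso iso

≈W-sym : ∀ {s} {n r : Fin s → ℕ} {As : ∀ t → SqMat (n t)} (x y : WreathProd s n r As) →
         x ≈W y → y ≈W x
≈W-sym x y x≈y t =
  (λ i → ≈Aut-sym (proj₁ (x t) i) (proj₁ (y t) i) (proj₁ (x≈y t) i)) , (λ i → sym (proj₂ (x≈y t) i))

≈W-trans : ∀ {s} {n r : Fin s → ℕ} {As : ∀ t → SqMat (n t)} (x y z : WreathProd s n r As) →
           x ≈W y → y ≈W z → x ≈W z
≈W-trans x y z x≈y y≈z t =
  (λ i → ≈Aut-trans (proj₁ (x t) i) (proj₁ (y t) i) (proj₁ (z t) i) (proj₁ (x≈y t) i) (proj₁ (y≈z t) i)) ,
  (λ i → trans (proj₂ (x≈y t) i) (proj₂ (y≈z t) i))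

WreathProd-size : ∀ {s} {n r : Fin s → ℕ} {As : ∀ t → SqMat (n t)} (N : Fin s → ℕ) →
                  (∀ t → HasSize (_≈Aut_ {A = As t}) (N t)) →
                  HasSize (_≈W_ {A = As}) (∏ s (λ t → N t ^ r t * r t !))
WreathProd-size {s} {n} {r} {As} N sizes =
  HasSize-Π s {λ t → (Fin (r t) → Aut (As t)) × Permutation′ (r t)}
    (λ x y → (∀ i → proj₁ x i ≈Aut proj₁ y i) × (proj₂ x ≈ proj₂ y))
    (λ {t} {x} {y} {z} (p , q) (p′ , q′) →
      (λ i → ≈Aut-trans (proj₁ x i) (proj₁ y i) (proj₁ z i) (p i) (p′ i)) , (λ i → trans (q i) (q′ i)))
    _ (λ t → HasSize-× (λ f g → ∀ i → f i ≈Aut g i) _≈_ (powers t) (Permutation-size (r t)))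
  where
  powers : ∀ t → HasSize {Fin (r t) → Aut (As t)} (λ f g → ∀ i → f i ≈Aut g i) (N t ^ r t)
  powers t = subst (HasSize (λ f g → ∀ i → f i ≈Aut g i)) (∏-const (r t) (N t))
    (HasSize-Π (r t) {λ _ → Aut (As t)} _≈Aut_ (λ {_} {x} {y} {z} → ≈Aut-trans x y z)
       (λ _ → N t) (λ _ → sizes t))

-- Zero rows and the sign of the weight

nonpositive⇒zeroRow : ∀ {n} {k} {A : SqMat n} → k ≤ℤ 0ℤ → IsWeighingOfWeight k A → ∀ i j → A i j ≡ 0ℤ
nonpositive⇒zeroRow {n} {k} {A} k≤0 w i j =
  [ (λ z → z) , (λ z → z) ]′ (ℤ.i*j≡0⇒i≡0∨j≡0 (A i j)
    (ℤ.≤-antisym (ℤ.≤-trans (term≤∑ n (λ l → 0≤i*i (A i l)) j)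
                            (ℤ.≤-trans (ℤ.≤-reflexive (rowNorm {A = A} w i)) k≤0))
                 (0≤i*i (A i j))))

nonzeroRow⇒PosWeighing : ∀ {n} {A : SqMat n} → IsIntWeighing A → ∀ i → ¬ (∀ j → A i j ≡ 0ℤ) → IsPosWeighing A
nonzeroRow⇒PosWeighing         (ℤ.+[1+ m ] , w) i A≢0 = ℤ.+[1+ m ] , _ , w
nonzeroRow⇒PosWeighing {A = A} (+ 0        , w) i A≢0 = ⊥-elim (A≢0 (nonpositive⇒zeroRow {A = A} ℤ.≤-refl w i))
nonzeroRow⇒PosWeighing {A = A} (ℤ.-[1+ m ] , w) i A≢0 = ⊥-elim (A≢0 (nonpositive⇒zeroRow {A = A} ℤ.-≤+ w i))

PosWeighing⇒nonzeroRow : ∀ {n} {A : SqMat n} → IsPosWeighing A → ∀ i → ¬ (∀ j → A i j ≡ 0ℤ)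
PosWeighing⇒nonzeroRow {n} {A} (k , k>0 , w) i A≡0 =
  case subst Positive (trans (sym (rowNorm {A = A} w i)) (∑-zero n (λ j → cong₂ _*ℤ_ (A≡0 j) (A≡0 j)))) k>0
  of λ ()

Carries-zeroRow : ∀ {I J I′ J′ : Set} {x : SignedBij I I′} {y : SignedBij J J′}
                  {M : I → J → ℤ} {N : I′ → J′ → ℤ} → Carries x y M N →
                  ∀ i → (∀ j → M i j ≡ 0ℤ) → ∀ j → N (to x i) j ≡ 0ℤ
Carries-zeroRow {x = x} {y} {M} {N} c i M≡0 j = begin
  N (to x i) j
    ≡⟨ sym (entry (Carries-inv c) (to x i) j) ⟩
  s • M (from x (to x i)) (from y j)
    ≡⟨ cong (λ i → s • M i (from y j)) (from-to x i) ⟩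
  s • M i (from y j)
    ≡⟨ cong (s •_) (M≡0 _) ⟩
  s • 0ℤ
    ≡⟨ •-zero s ⟩
  0ℤ ∎
  where
  s = sgn (inv x) (to x i) *ₛ sgn (inv y) j

theorem4p8 : (s : ℕ) (n r : Fin s → ℕ) (As : (t : Fin s) → SqMat (n t))
    (A : SqMat (blockDim s n r)) →
    Σ ℤ (λ k → Positive k × IsWeighingOfWeight k A) →
    (∀ t → 1 ≤ n t) →
    (∀ t → IsIntWeighing (As t)) →
    (∀ t → IsPrimitive (As t)) →
    (∀ t u → t ≢ u → ¬ HEquivHet (As t) (As u)) →
    A ∼H blockSum s n r As →
    Σ (Aut A → WreathProd s n r As) (λ φ →
    IsGroupIso (_≈Aut_ {A = A}) _≈W_ MulAut MulW φ)
    × ((N : Fin s → ℕ) → (∀ t → HasSize (_≈Aut_ {A = As t}) (N t)) →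
    HasSize (_≈Aut_ {A = A}) (∏ s (λ t → N t ^ r t * r t !)))
theorem4p8 s n r As A A-weighing n≥1 As-weighing As-primitive As-inequivalent A∼B =
  (_ , iso) ,
  λ N sizes → HasSize-iso {_≈H_ = _≈W_ {A = As}} (λ {x} {y} → ≈W-sym x y) (λ {x} {y} {z} → ≈W-trans x y z)
                iso (WreathProd-size N sizes)
  where
  D : BlockIndex n r → BlockIndex n r → ℤ
  D z z′ = blockSum s n r As (encode n r z) (encode n r z′)

  index : SignedBij (BlockIndex n r) (Fin (blockDim s n r))
  index = unsigned (encode n r) (decode n r) (decode-encode n r) (encode-decode n r)

  x y : SignedBij (BlockIndex n r) (Fin (blockDim s n r))
  x = index ⨾ proj₁ (∼H⇒Carries A∼B)
  y = index ⨾ proj₁ (proj₂ (∼H⇒Carries A∼B))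

  -- The H-equivalence, preceded by the re-indexing; conjugating by it takes automorphisms of `A` to
  -- automorphisms of `D`.
  D↝A : Carries x y D A
  D↝A = Carries-⨾ {x = index} {index} {M = D} (mkCarries λ _ _ → refl) (proj₂ (proj₂ (∼H⇒Carries A∼B)))

  -- A zero row of `As t` extends by zeros to a zero row of `D`, because copy `i` occurs there, and
  -- is carried to a zero row of `A`. The positive row norm of `A` excludes this.
  As-positive : ∀ t → Fin (r t) → IsPosWeighing (As t)
  As-positive t i = nonzeroRow⇒PosWeighing {A = As t} (As-weighing t) a λ As≡0 →
    PosWeighing⇒nonzeroRow {A = A} A-weighing (to x ((t , i) , a))
      (Carries-zeroRow D↝A ((t , i) , a) (zeroRow As≡0))
    where
    a = fromℕ< (n≥1 t)
    zeroRow : (∀ b → As t a b ≡ 0ℤ) → ∀ z → D ((t , i) , a) z ≡ 0ℤ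
    zeroRow As≡0 (l , b) with ≡-dec _≟_ _≟_ (t , i) l
    ... | yes refl = trans (blockSum-diagonal n r As (t , i) a b) (As≡0 b)
    ... | no k≢l   = blockSum-offDiagonal n r As a b k≢l

  open BlockDiagonal s n r As (λ t → fromℕ< (n≥1 t)) As-positive As-primitive As-inequivalent

  D≅W : Σ (SAut D → WreathProd s n r As) (IsGroupIso _≈A_ (_≈W_ {A = As}) MulA MulW)
  D≅W = wreath-iso D (blockSum-diagonal n r As) (blockSum-offDiagonal n r As)

  iso : IsGroupIso (_≈Aut_ {A = A}) (_≈W_ {A = As}) MulAut MulW (proj₁ D≅W ∘ conjA D↝A ∘ signed)
  iso = iso-∘ {_≈H_ = _≈A_} {_≈K_ = _≈W_ {A = As}} {MulAut} {MulA} {MulW}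
    (λ {x} {y} {z} → ≈W-trans x y z)
    (iso-∘ {_≈H_ = _≈A_} {_≈K_ = _≈A_} {MulAut} {MulA} {MulA} ≈A-trans signed-iso (conjA-iso D↝A))
    (proj₂ D≅W)
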